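{- Let $T=m_1^{e_1}m_2^{e_2}\cdots m_r^{e_r}\cdot 2^t$, where $m_1,\dots,m_r$ are distinct odd primes, $e_1,\dots,e_r$ are positive integers and $t\ge 0$ is an integer. For each odd prime $m$ let $g(m)$ denote the number of irreducible polynomials in $\mathbb{Z}_2[x]$ whose period equals $m$. Then there are at least $(2^t-1)(2^{tr}-2^{(t-1)r})\prod_{i=1}^r g(m_i)+2^{tr}\prod_{i=1}^r g(m_i)$ distinct polynomials $f\in\mathbb{Z}_2[x]$ with $f(0)\ne0$, having $x+1$ as a factor, whose period equals $T$.
   Context: For $f\in\mathbb{Z}_2[x]$ with $f(0)\ne0$, the period $p(f)$ is the least positive integer $e$ such that $f(x)$ divides $x^e-1$. -}

module Defs where

open import Data.Bool using (Bool; true; false; _xor_)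
open import Data.List using (List; []; _∷_; length; replicate; _++_)
open import Data.List.Membership.Propositional using (_∈_)
open import Data.List.Relation.Unary.All using (All)
open import Data.List.Relation.Unary.Unique.Propositional using (Unique)
open import Data.Nat using (ℕ; zero; suc; _*_; _<_; _≤_)
open import Data.Fin using (Fin)
open import Data.Product using (Σ; ∃; _×_)
open import Data.Sum using (_⊎_)
open import Data.Unit using (⊤)
open import Relation.Nullary using (¬_)
open import Relation.Binary.PropositionalEquality using (_≡_)

-- Polynomials over Z_2 as coefficient lists, lowest degree first.
Poly : Set
Poly = List Bool

-- Canonical form: no trailing zero coefficients (the zero polynomial is []).
Normal : Poly → Set
Normal []            = ⊤
Normal (b ∷ [])      = b ≡ true
Normal (_ ∷ c ∷ cs)  = Normal (c ∷ cs)

norm : Poly → Poly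
norm [] = []
norm (b ∷ bs) with norm bs
... | [] with b
...   | true  = true ∷ []
...   | false = []
norm (b ∷ bs) | c ∷ cs = b ∷ c ∷ cs

addP : Poly → Poly → Poly
addP [] g = g
addP (a ∷ f) [] = a ∷ f
addP (a ∷ f) (b ∷ g) = (a xor b) ∷ addP f g

mulP : Poly → Poly → Poly
mulP [] g = []
mulP (false ∷ f) g = false ∷ mulP f g
mulP (true ∷ f) g = addP g (false ∷ mulP f g)

_∣P_ : Poly → Poly → Set
f ∣P g = ∃ λ q → norm (mulP f q) ≡ norm g

monomial : ℕ → Poly
monomial e = replicate e false ++ (true ∷ [])

-- x^e - 1  (= x^e + 1 over Z_2)
xe-1 : ℕ → Poly
xe-1 e = norm (addP (monomial e) (true ∷ []))

ConstOne : Poly → Set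
ConstOne []       = Data.Empty.⊥ where import Data.Empty
ConstOne (b ∷ _)  = b ≡ true

HasPeriod : Poly → ℕ → Set
HasPeriod f e = (0 < e) × (f ∣P xe-1 e) × (∀ d → 0 < d → d < e → ¬ (f ∣P xe-1 d))

x+1 : Poly
x+1 = true ∷ true ∷ []

Irreducible : Poly → Set
Irreducible f = Normal f × (2 ≤ length f) ×
  (∀ a b → Normal a → Normal b → norm (mulP a b) ≡ f → (length a ≡ 1) ⊎ (length b ≡ 1))

AtLeast : (Poly → Set) → ℕ → Set
AtLeast P n = Σ (List Poly) λ L →
  (length L ≡ n) × Unique L × All Normal L × All P L

IsCount : (Poly → Set) → ℕ → Set
IsCount P n = Σ (List Poly) λ L →
  (length L ≡ n) × Unique L × All Normal L × All P L ×
  (∀ f → Normal f → P f → f ∈ L)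

prodFin : (r : ℕ) → (Fin r → ℕ) → ℕ
prodFin zero    h = 1
prodFin (suc r) h = h Fin.zero * prodFin r (λ i → h (Fin.suc i))
  where import Data.Fin as Fin

-- Write M = ∏ mᵢ^eᵢ (odd), A = 2^t, B = 2^(t-1), so T = M·A and xᵀ + 1 = (x^M + 1)^A.  Let
-- Ψᵢ = (x^(mᵢ^eᵢ) + 1)/(x^(mᵢ^(eᵢ-1)) + 1) (Ψᵢ = 1 if eᵢ = 1), pick irreducibles pᵢ of period mᵢ and
-- exponents 1 ≤ bᵢ ≤ A, and put F = (x+1)^a · ∏ᵢ pᵢ^bᵢ · Ψᵢ for 1 ≤ a ≤ A.  Then F ∣ (x^M + 1)^A, and
-- F has period exactly T once t = 0 or some exponent a, bᵢ exceeds B: pᵢ resp. Ψᵢ force mᵢ^eᵢ to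
-- divide the period, and c^(B+1) with c ∣ x^M + 1 cannot divide x^(M·B) + 1 = (x^M + 1)^B since
-- x^M + 1 is squarefree (its derivative is a power of x).  By unique factorisation the data
-- determine F; a = A with any exponents, plus a < A with some bᵢ > B, give the stated count.
module Submission where

open import Defs
open import Data.Nat using (ℕ; _≤_)
open import Data.Nat.Primality using (Prime)
open import Data.Fin using (Fin)
open import Data.List using (List; length)
open import Data.List.Relation.Unary.All as All using (All)
open import Data.List.Relation.Unary.Unique.Propositional using (Unique)
open import Data.Product using (_×_)
open import Data.Unit using (tt)
open import Function.Definitions using (Injective)
open import Relation.Binary.PropositionalEquality

module PrimePowers where

  open import Data.Nat
  open import Data.Nat.Properties
  open import Data.Nat.Divisibility
  open import Data.Nat.Coprimality using (Coprime; coprime-divisor)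
  open import Data.Nat.Primality using (euclidsLemma; prime⇒irreducible; prime⇒nonZero; prime⇒nonTrivial)
  open import Data.Nat.DivMod using (_/_; m≡m%n+[m/n]*n)
  open import Data.Fin using (zero; suc)
  open import Data.Empty using (⊥-elim)
  open import Data.Sum using (inj₁; inj₂)
  open import Relation.Nullary using (¬_; yes; no)
  open import Data.Product using (Σ; _×_; _,_)

  prime≥2 : ∀ {m} → Prime m → 2 ≤ m
  prime≥2 {m} pm = nonTrivial⇒n>1 m ⦃ prime⇒nonTrivial pm ⦄

  prime≢1 : ∀ {m} → Prime m → m ≢ 1
  prime≢1 pm refl with prime≥2 pm
  ... | s≤s ()

  ∤⇒coprime : ∀ {m d} → Prime m → ¬ (m ∣ d) → Coprime d m
  ∤⇒coprime {m} {d} pm nd (id , im) with prime⇒irreducible pm im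
  ... | inj₁ e = e
  ... | inj₂ refl = ⊥-elim (nd id)

  ∣pow-coprime⇒≡1 : ∀ {m d} e → Prime m → d ∣ m ^ e → ¬ (m ∣ d) → d ≡ 1
  ∣pow-coprime⇒≡1 zero pm dd nd = ∣1⇒≡1 dd
  ∣pow-coprime⇒≡1 (suc e) pm dd nd = ∣pow-coprime⇒≡1 e pm (coprime-divisor (∤⇒coprime pm nd) dd) nd

  -- A proper divisor of m^(e+1) divides mᵉ: this is how the minimality of a period is checked.
  proper∣pow⇒∣pred : ∀ {m d} e → Prime m → d ∣ m ^ suc e → d ≢ m ^ suc e → d ∣ m ^ e
  proper∣pow⇒∣pred {m} {d} e pm dd ne with m ∣? d
  ... | no nd rewrite ∣pow-coprime⇒≡1 (suc e) pm dd nd = 1∣ _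
  ... | yes (divides q refl) = lift e q∣ q≢
    where
    instance _ = prime⇒nonZero pm
    q∣ : q ∣ m ^ e
    q∣ = *-cancelʳ-∣ m (subst (q * m ∣_) (*-comm m (m ^ e)) dd)
    q≢ : q ≢ m ^ e
    q≢ qe = ne (trans (cong (_* m) qe) (*-comm (m ^ e) m))
    lift : ∀ e → q ∣ m ^ e → q ≢ m ^ e → q * m ∣ m ^ e
    lift zero q∣ q≢ = ⊥-elim (q≢ (∣1⇒≡1 q∣))
    lift (suc e') q∣ q≢ = subst (q * m ∣_) (*-comm (m ^ e') m) (*-monoˡ-∣ m (proper∣pow⇒∣pred e' pm q∣ q≢))

  multiple∣proper⇒∣pred : ∀ {q g} M t → .{{_ : NonZero M}} → Prime q → M ∣ g → g ∣ M * q ^ t → g ≢ M * q ^ t →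
    (0 < t) × (g ∣ M * q ^ (t ∸ 1))
  multiple∣proper⇒∣pred {q} M t pq (divides k refl) g∣ g≢ = by-exponent t k∣ k≢
    where
    k∣ : k ∣ q ^ t
    k∣ = *-cancelʳ-∣ M (subst (k * M ∣_) (*-comm M (q ^ t)) g∣)
    k≢ : k ≢ q ^ t
    k≢ e = g≢ (trans (cong (_* M) e) (*-comm (q ^ t) M))
    by-exponent : ∀ t → k ∣ q ^ t → k ≢ q ^ t → (0 < t) × (k * M ∣ M * q ^ (t ∸ 1))
    by-exponent zero k∣ k≢ = ⊥-elim (k≢ (∣1⇒≡1 k∣))
    by-exponent (suc t') k∣ k≢ = s≤s z≤n , subst (k * M ∣_) (*-comm (q ^ t') M) (*-monoˡ-∣ M (proper∣pow⇒∣pred t' pq k∣ k≢))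

  m∣m^e : ∀ m e → 1 ≤ e → m ∣ m ^ e
  m∣m^e m (suc e) _ = ∣m⇒∣m*n (m ^ e) ∣-refl

  prime∣pow⇒∣ : ∀ {q m} e → Prime q → q ∣ m ^ e → q ∣ m
  prime∣pow⇒∣ zero pq d = ⊥-elim (prime≢1 pq (∣1⇒≡1 d))
  prime∣pow⇒∣ {q} {m} (suc e) pq d with euclidsLemma m (m ^ e) pq d
  ... | inj₁ x = x
  ... | inj₂ y = prime∣pow⇒∣ e pq y

  prime∣prime⇒≡ : ∀ {q m} → Prime q → Prime m → q ∣ m → q ≡ m
  prime∣prime⇒≡ pq pm d with prime⇒irreducible pm d
  ... | inj₁ e = ⊥-elim (prime≢1 pq e)
  ... | inj₂ e = e

  factor∣prodFin : ∀ r (h : Fin r → ℕ) i → h i ∣ prodFin r h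
  factor∣prodFin (suc r) h zero = ∣m⇒∣m*n (prodFin r (λ i → h (suc i))) ∣-refl
  factor∣prodFin (suc r) h (suc i) = ∣n⇒∣m*n (h zero) (factor∣prodFin r (λ i → h (suc i)) i)

  prime∣prodFin : ∀ {q} r (h : Fin r → ℕ) → Prime q → q ∣ prodFin r h → Σ (Fin r) λ i → q ∣ h i
  prime∣prodFin zero h pq d = ⊥-elim (prime≢1 pq (∣1⇒≡1 d))
  prime∣prodFin (suc r) h pq d with euclidsLemma (h zero) (prodFin r (λ i → h (suc i))) pq d
  ... | inj₁ x = zero , x
  ... | inj₂ y with prime∣prodFin r (λ i → h (suc i)) pq y
  ... | i , z = suc i , z

  prodFin-cong : ∀ r {h h' : Fin r → ℕ} → (∀ i → h i ≡ h' i) → prodFin r h ≡ prodFin r h'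
  prodFin-cong zero eq = refl
  prodFin-cong (suc r) eq = cong₂ _*_ (eq zero) (prodFin-cong r (λ i → eq (suc i)))

  primePowerProd : ∀ r → (Fin r → ℕ) → (Fin r → ℕ) → ℕ
  primePowerProd r m e = prodFin r (λ i → m i ^ e i)

  tail-injective : ∀ {r} {m : Fin (suc r) → ℕ} → Injective _≡_ _≡_ m → Injective _≡_ _≡_ (λ i → m (suc i))
  tail-injective inj e with inj e
  ... | refl = refl

  head∤rest : ∀ r (m e : Fin (suc r) → ℕ) → Injective _≡_ _≡_ m → (∀ i → Prime (m i)) →
    ¬ (m zero ∣ primePowerProd r (λ i → m (suc i)) (λ i → e (suc i)))
  head∤rest r m e inj pr d with prime∣prodFin r (λ i → m (suc i) ^ e (suc i)) (pr zero) d
  ... | i , di with inj (prime∣prime⇒≡ (pr zero) (pr (suc i)) (prime∣pow⇒∣ (e (suc i)) (pr zero) di))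
  ... | ()

  head-coprime-rest : ∀ r (m e : Fin (suc r) → ℕ) → Injective _≡_ _≡_ m → (∀ i → Prime (m i)) →
    Coprime (m zero ^ e zero) (primePowerProd r (λ i → m (suc i)) (λ i → e (suc i)))
  head-coprime-rest r m e inj pr {d} (d1 , d2) with m zero ∣? d
  ... | yes md = ⊥-elim (head∤rest r m e inj pr (∣-trans md d2))
  ... | no nd = ∣pow-coprime⇒≡1 (e zero) (pr zero) d1 nd

  primePowerProd∣ : ∀ r (m e : Fin r → ℕ) {g} → Injective _≡_ _≡_ m → (∀ i → Prime (m i)) →
    (∀ i → m i ^ e i ∣ g) → primePowerProd r m e ∣ g
  primePowerProd∣ zero m e inj pr h = 1∣ _
  primePowerProd∣ (suc r) m e {g} inj pr h
    with primePowerProd∣ r (λ i → m (suc i)) (λ i → e (suc i)) (tail-injective {m = m} inj) (λ i → pr (suc i)) (λ i → h (suc i))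
  ... | divides k refl with coprime-divisor (head-coprime-rest r m e inj pr) (subst (m zero ^ e zero ∣_) (*-comm k rest) (h zero))
    where rest = primePowerProd r (λ i → m (suc i)) (λ i → e (suc i))
  ... | divides j refl = divides j (*-assoc j (m zero ^ e zero) (primePowerProd r (λ i → m (suc i)) (λ i → e (suc i))))

  Odd : ℕ → Set
  Odd n = Σ ℕ λ k → n ≡ suc (k * 2)

  %2≡1⇒odd : ∀ {m} → m % 2 ≡ 1 → Odd m
  %2≡1⇒odd {m} e = m / 2 , trans (m≡m%n+[m/n]*n m 2) (cong (_+ (m / 2) * 2) e)

  odd-* : ∀ {a b} → Odd a → Odd b → Odd (a * b)
  odd-* (x , refl) (y , refl) = x + y + x * y * 2 , expand x y
    where
    open import Data.Nat.Solver using (module +-*-Solver)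
    open +-*-Solver
    expand : ∀ x y → suc (x * 2) * suc (y * 2) ≡ suc ((x + y + x * y * 2) * 2)
    expand = solve 2 (λ x y → (con 1 :+ x :* con 2) :* (con 1 :+ y :* con 2) := con 1 :+ (x :+ y :+ x :* y :* con 2) :* con 2) refl

  odd-^ : ∀ {a} n → Odd a → Odd (a ^ n)
  odd-^ zero o = 0 , refl
  odd-^ (suc n) o = odd-* o (odd-^ n o)

  odd-primePowerProd : ∀ r (m e : Fin r → ℕ) → (∀ i → Odd (m i)) → Odd (primePowerProd r m e)
  odd-primePowerProd zero m e o = 0 , refl
  odd-primePowerProd (suc r) m e o =
    odd-* (odd-^ (e zero) (o zero)) (odd-primePowerProd r (λ i → m (suc i)) (λ i → e (suc i)) (λ i → o (suc i)))

-- The ring Z₂[x] and everything about polynomials.  Polynomials are the coefficient lists of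
-- Defs; they are compared coefficientwise (_≈_), which ignores trailing zeros.
module Polynomials where

  open PrimePowers
  open import Data.Bool using (Bool; true; false; _xor_; _∧_; if_then_else_)
  open import Data.Bool.Properties using (∧-comm; xor-assoc; xor-comm; xor-same; xor-identityʳ)
  open import Data.List using (List; []; _∷_; length)
  open import Data.Nat using (ℕ; zero; suc; _≤_; _<_; z≤n; s≤s; _^_)
    renaming (_+_ to _+ℕ_; _*_ to _*ℕ_)
  import Data.Nat as ℕ
  import Data.Nat.Properties as NP
  import Data.Nat.Divisibility as ND
  open import Data.Nat.GCD using (module Bézout; GCD)
  open import Data.Empty using (⊥-elim)
  open import Data.Unit using (tt)
  open import Data.Sum using (_⊎_; inj₁; inj₂)
  open import Data.Product using (Σ; ∃; _×_; _,_; proj₁; proj₂)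
  open import Relation.Nullary using (¬_)
  open import Relation.Binary using (IsEquivalence; tri<; tri≈; tri>)
  open import Algebra.Bundles using (CommutativeRing)
  open import Data.Maybe using (nothing)
  open import Function using (id)
  open import Tactic.RingSolver.Core.AlmostCommutativeRing using (AlmostCommutativeRing; fromCommutativeRing)
  open import Tactic.RingSolver using (solve-∀)
  import Relation.Binary.Reasoning.Setoid

  coeff : Poly → ℕ → Bool
  coeff [] _ = false
  coeff (b ∷ f) zero = b
  coeff (b ∷ f) (suc k) = coeff f k

  infix 4 _≈_
  record _≈_ (f g : Poly) : Set where
    constructor mk
    field at : ∀ k → coeff f k ≡ coeff g k
  open _≈_ public

  ≈-refl : ∀ {f} → f ≈ f
  ≈-refl = mk λ k → refl

  ≈-sym : ∀ {f g} → f ≈ g → g ≈ f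
  ≈-sym p = mk λ k → sym (at p k)

  ≈-trans : ∀ {f g h} → f ≈ g → g ≈ h → f ≈ h
  ≈-trans p q = mk λ k → trans (at p k) (at q k)

  ≡⇒≈ : ∀ {a b} → a ≡ b → a ≈ b
  ≡⇒≈ refl = ≈-refl

  cons-cong : ∀ {b f g} → f ≈ g → (b ∷ f) ≈ (b ∷ g)
  cons-cong p = mk λ { zero → refl ; (suc k) → at p k }

  cons-inv : ∀ {b c f g} → (b ∷ f) ≈ (c ∷ g) → f ≈ g
  cons-inv p = mk λ k → at p (suc k)

  [false]≈[] : (false ∷ []) ≈ []
  [false]≈[] = mk λ { zero → refl ; (suc k) → refl }

  coeff-add : ∀ f g k → coeff (addP f g) k ≡ coeff f k xor coeff g k
  coeff-add [] g k = refl
  coeff-add (a ∷ f) [] k = sym (xor-identityʳ _)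
  coeff-add (a ∷ f) (b ∷ g) zero = refl
  coeff-add (a ∷ f) (b ∷ g) (suc k) = coeff-add f g k

  infixl 6 _+_
  infixl 7 _*_
  _+_ : Poly → Poly → Poly
  _+_ = addP
  _*_ : Poly → Poly → Poly
  _*_ = mulP
  0P 1P X : Poly
  0P = []
  1P = true ∷ []
  X = false ∷ true ∷ []

  +-cong : ∀ {f f' g g'} → f ≈ f' → g ≈ g' → f + g ≈ f' + g'
  +-cong {f} {f'} {g} {g'} p q = mk λ k →
    trans (coeff-add f g k) (trans (cong₂ _xor_ (at p k) (at q k)) (sym (coeff-add f' g' k)))

  +-comm : ∀ f g → f + g ≈ g + f
  +-comm f g = mk λ k →
    trans (coeff-add f g k) (trans (xor-comm (coeff f k) (coeff g k)) (sym (coeff-add g f k)))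

  +-assoc : ∀ f g h → (f + g) + h ≈ f + (g + h)
  +-assoc f g h = mk λ k → begin
      coeff ((f + g) + h) k                       ≡⟨ coeff-add (f + g) h k ⟩
      coeff (f + g) k xor coeff h k               ≡⟨ cong (_xor coeff h k) (coeff-add f g k) ⟩
      (coeff f k xor coeff g k) xor coeff h k     ≡⟨ xor-assoc (coeff f k) (coeff g k) (coeff h k) ⟩
      coeff f k xor (coeff g k xor coeff h k)     ≡⟨ cong (coeff f k xor_) (coeff-add g h k) ⟨
      coeff f k xor coeff (g + h) k               ≡⟨ coeff-add f (g + h) k ⟨
      coeff (f + (g + h)) k                       ∎
    where open ≡-Reasoning

  +-idʳ : ∀ f → f + 0P ≈ f
  +-idʳ f = mk λ k → trans (coeff-add f [] k) (xor-identityʳ _)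

  +-self : ∀ f → f + f ≈ 0P
  +-self f = mk λ k → trans (coeff-add f f k) (xor-same (coeff f k))

  +-twice : ∀ a b → (b + a) + a ≈ b
  +-twice a b = ≈-trans (+-assoc b a a) (≈-trans (+-cong {b} ≈-refl (+-self a)) (+-idʳ b))

  cancel-doubles : ∀ {a b} u v → a + (u + u) ≈ b + (v + v) → a ≈ b
  cancel-doubles {a} {b} u v e =
    ≈-trans (≈-sym (≈-trans (+-cong {a} ≈-refl (+-self u)) (+-idʳ a))) (≈-trans e (≈-trans (+-cong {b} ≈-refl (+-self v)) (+-idʳ b)))

  scale : Bool → Poly → Poly
  scale true g = g
  scale false g = []

  coeff-scale : ∀ b g k → coeff (scale b g) k ≡ b ∧ coeff g k
  coeff-scale true g k = refl
  coeff-scale false g k = refl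

  *-consˡ : ∀ b f g → (b ∷ f) * g ≈ scale b g + (false ∷ (f * g))
  *-consˡ false f g = ≈-refl
  *-consˡ true f g = ≈-refl

  *-zeroʳ : ∀ f → f * 0P ≈ 0P
  *-zeroʳ [] = ≈-refl
  *-zeroʳ (false ∷ f) = ≈-trans (cons-cong (*-zeroʳ f)) [false]≈[]
  *-zeroʳ (true ∷ f) = ≈-trans (cons-cong (*-zeroʳ f)) [false]≈[]

  zero-*ˡ : ∀ {f} → f ≈ 0P → ∀ g → f * g ≈ 0P
  zero-*ˡ {[]} p g = ≈-refl
  zero-*ˡ {false ∷ f} p g = ≈-trans (cons-cong (zero-*ˡ {f} (mk λ k → at p (suc k)) g)) [false]≈[]
  zero-*ˡ {true ∷ f} p g with at p zero
  ... | ()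

  *-congˡ : ∀ {f f'} → f ≈ f' → ∀ g → f * g ≈ f' * g
  *-congˡ {[]} {f'} p g = ≈-sym (zero-*ˡ (≈-sym p) g)
  *-congˡ {b ∷ f} {[]} p g = zero-*ˡ p g
  *-congˡ {b ∷ f} {b' ∷ f'} p g with at p zero
  ... | refl = ≈-trans (*-consˡ b f g) (≈-trans (+-cong {scale b g} ≈-refl (cons-cong (*-congˡ (cons-inv p) g)))
                 (≈-sym (*-consˡ b f' g)))

  -- Rearranging a sum of four terms (needed before the ring solver is available).
  +-interchange : ∀ p q r s → (p + q) + (r + s) ≈ (p + r) + (q + s)
  +-interchange p q r s = mk λ k →
    trans (expand p q r s k) (trans (xor-interchange (coeff p k) (coeff q k) (coeff r k) (coeff s k)) (sym (expand p r q s k)))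
    where
    expand : ∀ a b c d k → coeff ((a + b) + (c + d)) k ≡ (coeff a k xor coeff b k) xor (coeff c k xor coeff d k)
    expand a b c d k = trans (coeff-add (a + b) (c + d) k) (cong₂ _xor_ (coeff-add a b k) (coeff-add c d k))
    xor-interchange : ∀ P Q R S → (P xor Q) xor (R xor S) ≡ (P xor R) xor (Q xor S)
    xor-interchange P Q R S = begin
      (P xor Q) xor (R xor S)             ≡⟨ xor-assoc P Q (R xor S) ⟩
      P xor (Q xor (R xor S))             ≡⟨ cong (P xor_) (xor-assoc Q R S) ⟨
      P xor ((Q xor R) xor S)             ≡⟨ cong (λ z → P xor (z xor S)) (xor-comm Q R) ⟩
      P xor ((R xor Q) xor S)             ≡⟨ cong (P xor_) (xor-assoc R Q S) ⟩
      P xor (R xor (Q xor S))             ≡⟨ xor-assoc P R (Q xor S) ⟨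
      (P xor R) xor (Q xor S)             ∎
      where open ≡-Reasoning

  *-distribʳ : ∀ f f' g → (f + f') * g ≈ f * g + f' * g
  *-distribʳ [] f' g = ≈-refl
  *-distribʳ (a ∷ f) [] g = ≈-sym (+-idʳ _)
  *-distribʳ (a ∷ f) (b ∷ f') g =
    ≈-trans (*-consˡ (a xor b) (f + f') g)
    (≈-trans (+-cong (scale-xor a b) (≈-trans (cons-cong (*-distribʳ f f' g)) (mk λ { zero → refl ; (suc k) → refl })))
    (≈-trans (+-interchange (scale a g) (scale b g) (false ∷ (f * g)) (false ∷ (f' * g)))
    (+-cong (≈-sym (*-consˡ a f g)) (≈-sym (*-consˡ b f' g)))))
    where
    scale-xor : ∀ a b → scale (a xor b) g ≈ scale a g + scale b g
    scale-xor false b = ≈-refl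
    scale-xor true false = ≈-sym (+-idʳ _)
    scale-xor true true = ≈-sym (+-self g)

  *-congʳ : ∀ f {g g'} → g ≈ g' → f * g ≈ f * g'
  *-congʳ [] p = ≈-refl
  *-congʳ (false ∷ f) p = cons-cong (*-congʳ f p)
  *-congʳ (true ∷ f) p = +-cong p (cons-cong (*-congʳ f p))

  *-consʳ : ∀ f b g → f * (b ∷ g) ≈ scale b f + (false ∷ (f * g))
  *-consʳ [] false g = ≈-sym [false]≈[]
  *-consʳ [] true g = ≈-sym [false]≈[]
  *-consʳ (a ∷ f) b g =
    ≈-trans (*-consˡ a f (b ∷ g)) (≈-trans (+-cong {scale a (b ∷ g)} ≈-refl (cons-cong (*-consʳ f b g))) (mk coeffwise))
    where
    swap : ∀ x y z → x xor (y xor z) ≡ y xor (x xor z)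
    swap x y z = trans (sym (xor-assoc x y z)) (trans (cong (_xor z) (xor-comm x y)) (xor-assoc y x z))
    coeffwise : ∀ k → coeff (scale a (b ∷ g) + (false ∷ (scale b f + (false ∷ (f * g))))) k
                    ≡ coeff (scale b (a ∷ f) + (false ∷ ((a ∷ f) * g))) k
    coeffwise zero rewrite coeff-add (scale a (b ∷ g)) (false ∷ (scale b f + (false ∷ (f * g)))) zero
      | coeff-add (scale b (a ∷ f)) (false ∷ ((a ∷ f) * g)) zero
      | coeff-scale a (b ∷ g) zero | coeff-scale b (a ∷ f) zero = cong (_xor false) (∧-comm a b)
    coeffwise (suc k) rewrite coeff-add (scale a (b ∷ g)) (false ∷ (scale b f + (false ∷ (f * g)))) (suc k)
      | coeff-add (scale b (a ∷ f)) (false ∷ ((a ∷ f) * g)) (suc k)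
      | coeff-scale a (b ∷ g) (suc k) | coeff-scale b (a ∷ f) (suc k)
      | coeff-add (scale b f) (false ∷ (f * g)) k | at (*-consˡ a f g) k
      | coeff-add (scale a g) (false ∷ (f * g)) k | coeff-scale a g k | coeff-scale b f k
      = swap (a ∧ coeff g k) (b ∧ coeff f k) (coeff (false ∷ (f * g)) k)

  *-comm : ∀ f g → f * g ≈ g * f
  *-comm [] g = ≈-sym (*-zeroʳ g)
  *-comm (b ∷ f) g =
    ≈-trans (*-consˡ b f g) (≈-trans (+-cong {scale b g} ≈-refl (cons-cong (*-comm f g))) (≈-sym (*-consʳ g b f)))

  *-distribˡ : ∀ f g h → f * (g + h) ≈ f * g + f * h
  *-distribˡ f g h = ≈-trans (*-comm f (g + h)) (≈-trans (*-distribʳ g h f) (+-cong (*-comm g f) (*-comm h f)))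

  scale-* : ∀ b g h → scale b g * h ≈ scale b (g * h)
  scale-* true g h = ≈-refl
  scale-* false g h = ≈-refl

  *-assoc : ∀ f g h → (f * g) * h ≈ f * (g * h)
  *-assoc [] g h = ≈-refl
  *-assoc (b ∷ f) g h =
    ≈-trans (*-congˡ (*-consˡ b f g) h) (≈-trans (*-distribʳ (scale b g) (false ∷ (f * g)) h)
    (≈-trans (+-cong (scale-* b g h) (cons-cong (*-assoc f g h))) (≈-sym (*-consˡ b f (g * h)))))

  *-idˡ : ∀ g → 1P * g ≈ g
  *-idˡ g = ≈-trans (+-cong {g} ≈-refl [false]≈[]) (+-idʳ g)

  *-idʳ : ∀ g → g * 1P ≈ g
  *-idʳ g = ≈-trans (*-comm g 1P) (*-idˡ g)

  *-cong : ∀ {f f' g g'} → f ≈ f' → g ≈ g' → f * g ≈ f' * g'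
  *-cong {f} {f'} {g} p q = ≈-trans (*-congˡ p g) (*-congʳ f' q)

  -- Z₂[x] is a commutative ring (with -f = f), so the ring solver can normalise identities.
  PolyRing : CommutativeRing _ _
  PolyRing = record
    { Carrier = Poly ; _≈_ = _≈_ ; _+_ = _+_ ; _*_ = _*_ ; -_ = id ; 0# = 0P ; 1# = 1P
    ; isCommutativeRing = record
      { isRing = record
        { +-isAbelianGroup = record
          { isGroup = record
            { isMonoid = record
              { isSemigroup = record
                { isMagma = record { isEquivalence = ≈-isEquivalence ; ∙-cong = +-cong }
                ; assoc = +-assoc }
              ; identity = (λ f → ≈-refl) , +-idʳ }
            ; inverse = +-self , +-self
            ; ⁻¹-cong = id }
          ; comm = +-comm }
        ; *-cong = *-cong
        ; *-assoc = *-assoc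
        ; *-identity = *-idˡ , *-idʳ
        ; distrib = *-distribˡ , (λ x y z → *-distribʳ y z x) }
      ; *-comm = *-comm } }
    where
    ≈-isEquivalence : IsEquivalence _≈_
    ≈-isEquivalence = record { refl = ≈-refl ; sym = ≈-sym ; trans = ≈-trans }

  PolySolverRing : AlmostCommutativeRing _ _
  PolySolverRing = fromCommutativeRing PolyRing (λ _ → nothing)

  module ≈-Reasoning = Relation.Binary.Reasoning.Setoid (CommutativeRing.setoid PolyRing)

  -- Normal forms: norm f is the unique normal representative of f, so that the frozen
  -- notions (stated with norm and ≡) can be traded for ones stated with ≈.
  norm-≈ : ∀ v → norm v ≈ v
  norm-≈ [] = ≈-refl
  norm-≈ (b ∷ bs) with norm bs | norm-≈ bs
  ... | [] | p with b
  ...   | true = cons-cong p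
  ...   | false = ≈-trans (≈-sym [false]≈[]) (cons-cong p)
  norm-≈ (b ∷ bs) | c ∷ cs | p = cons-cong p

  norm-normal : ∀ v → Normal (norm v)
  norm-normal [] = tt
  norm-normal (b ∷ bs) with norm bs | norm-normal bs
  ... | [] | _ with b
  ...   | true = refl
  ...   | false = tt
  norm-normal (b ∷ bs) | c ∷ cs | n = n

  normal-nonzero : ∀ c cs → Normal (c ∷ cs) → ¬ ((c ∷ cs) ≈ [])
  normal-nonzero c cs n p with witness c cs n
    where
    witness : ∀ c cs → Normal (c ∷ cs) → ∃ λ k → coeff (c ∷ cs) k ≡ true
    witness c [] n = zero , n
    witness c (d ∷ ds) n with witness d ds n
    ... | k , e = suc k , e
  ... | k , e with trans (sym e) (at p k)
  ... | ()

  normal-unique : ∀ u w → Normal u → Normal w → u ≈ w → u ≡ w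
  normal-unique [] [] nu nw p = refl
  normal-unique [] (c ∷ cs) nu nw p = ⊥-elim (normal-nonzero c cs nw (≈-sym p))
  normal-unique (c ∷ cs) [] nu nw p = ⊥-elim (normal-nonzero c cs nu p)
  normal-unique (b ∷ []) (c ∷ []) nu nw p = cong (_∷ []) (trans nu (sym nw))
  normal-unique (b ∷ []) (c ∷ d ∷ ds) nu nw p = ⊥-elim (normal-nonzero d ds nw (≈-sym (cons-inv p)))
  normal-unique (b ∷ d ∷ ds) (c ∷ []) nu nw p = ⊥-elim (normal-nonzero d ds nu (cons-inv p))
  normal-unique (b ∷ d ∷ ds) (c ∷ e ∷ es) nu nw p =
    cong₂ _∷_ (at p zero) (normal-unique (d ∷ ds) (e ∷ es) nu nw (cons-inv p))

  ≈⇒norm≡ : ∀ {f g} → f ≈ g → norm f ≡ norm g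
  ≈⇒norm≡ {f} {g} p =
    normal-unique _ _ (norm-normal f) (norm-normal g) (≈-trans (norm-≈ f) (≈-trans p (≈-sym (norm-≈ g))))

  norm≡⇒≈ : ∀ {f g} → norm f ≡ norm g → f ≈ g
  norm≡⇒≈ {f} {g} e = ≈-trans (≈-sym (norm-≈ f)) (≈-trans (≡⇒≈ e) (norm-≈ g))

  norm-id : ∀ f → Normal f → norm f ≡ f
  norm-id f n = normal-unique _ _ (norm-normal f) n (norm-≈ f)

  Bounded : Poly → ℕ → Set
  Bounded v e = ∀ k → e ≤ k → coeff v k ≡ false

  record Deg (v : Poly) (d : ℕ) : Set where
    constructor _,ᵈ_
    field top : coeff v d ≡ true
          bounded : Bounded v (suc d)

  NonZeroP : Poly → Set
  NonZeroP v = ¬ (v ≈ 0P)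

  deg-≈ : ∀ {v w d} → Deg v d → v ≈ w → Deg w d
  deg-≈ (t ,ᵈ b) p = trans (sym (at p _)) t ,ᵈ λ k le → trans (sym (at p k)) (b k le)

  deg⇒nonZero : ∀ {v d} → Deg v d → NonZeroP v
  deg⇒nonZero (t ,ᵈ b) p with trans (sym t) (at p _)
  ... | ()

  normal-deg : ∀ c cs → Normal (c ∷ cs) → Deg (c ∷ cs) (length cs)
  normal-deg c [] n = n ,ᵈ λ { (suc k) le → refl }
  normal-deg c (d ∷ ds) n with normal-deg d ds n
  ... | t ,ᵈ b = t ,ᵈ λ { (suc k) (s≤s le) → b k le }

  zero-or-deg : ∀ v → (v ≈ 0P) ⊎ (∃ λ d → Deg v d)
  zero-or-deg v with norm v in eq
  ... | [] = inj₁ (≈-trans (≈-sym (norm-≈ v)) (≡⇒≈ eq))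
  ... | c ∷ cs = inj₂ (length cs , deg-≈ (normal-deg c cs (subst Normal eq (norm-normal v)))
                                          (≈-trans (≡⇒≈ (sym eq)) (norm-≈ v)))

  nonZero⇒deg : ∀ v → NonZeroP v → ∃ λ d → Deg v d
  nonZero⇒deg v nz with zero-or-deg v
  ... | inj₁ p = ⊥-elim (nz p)
  ... | inj₂ q = q

  deg-unique : ∀ {v d d'} → Deg v d → Deg v d' → d ≡ d'
  deg-unique {v} {d} {d'} (t ,ᵈ b) (t' ,ᵈ b') with NP.<-cmp d d'
  ... | tri< lt _ _ with trans (sym t') (b d' lt)
  ... | ()
  deg-unique (t ,ᵈ b) (t' ,ᵈ b') | tri≈ _ e _ = e
  deg-unique {v} {d} {d'} (t ,ᵈ b) (t' ,ᵈ b') | tri> _ _ gt with trans (sym t) (b' d gt)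
  ... | ()

  deg-* : ∀ {a b da db} → Deg a da → Deg b db → Deg (a * b) (da +ℕ db)
  deg-* {[]} (() ,ᵈ _)
  deg-* {c ∷ a'} {b} {zero} (refl ,ᵈ ba) db =
    deg-≈ db (≈-sym (≈-trans (+-cong {b} ≈-refl (≈-trans (cons-cong (zero-*ˡ a'≈0 b)) [false]≈[])) (+-idʳ b)))
    where
    a'≈0 : a' ≈ 0P
    a'≈0 = mk λ k → ba (suc k) (s≤s z≤n)
  deg-* {c ∷ a'} {b} {suc da} {db} (t ,ᵈ ba) dgb =
    deg-≈ (deg-add (bounded-scale c dgb) (s≤s (NP.m≤n+m db da)) (deg-shift (deg-* {a'} (t ,ᵈ λ k le → ba (suc k) (s≤s le)) dgb)))
          (≈-sym (*-consˡ c a' b))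
    where
    deg-shift : ∀ {v d} → Deg v d → Deg (false ∷ v) (suc d)
    deg-shift (t ,ᵈ b) = t ,ᵈ λ { (suc k) (s≤s le) → b k le }
    bounded-scale : ∀ c {b db} → Deg b db → Bounded (scale c b) (suc db)
    bounded-scale true (t ,ᵈ bb) = bb
    bounded-scale false _ k _ = refl
    deg-add : ∀ {u w e d} → Bounded u e → e ≤ d → Deg w d → Deg (u + w) d
    deg-add {u} {w} {e} {d} bu le (t ,ᵈ b) =
      trans (coeff-add u w d) (trans (cong (_xor coeff w d) (bu d le)) t) ,ᵈ
      λ k lk → trans (coeff-add u w k) (cong₂ _xor_ (bu k (NP.≤-trans le (NP.≤-trans (NP.n≤1+n d) lk))) (b k lk))

  deg-1 : Deg 1P 0
  deg-1 = refl ,ᵈ λ { (suc k) _ → refl }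

  1≉0 : NonZeroP 1P
  1≉0 = deg⇒nonZero deg-1

  nonZero-* : ∀ {a b} → NonZeroP a → NonZeroP b → NonZeroP (a * b)
  nonZero-* {a} {b} na nb with nonZero⇒deg a na | nonZero⇒deg b nb
  ... | da , pa | db , pb = deg⇒nonZero (deg-* pa pb)

  *-cancelˡ : ∀ {c x y} → NonZeroP c → c * x ≈ c * y → x ≈ y
  *-cancelˡ {c} {x} {y} nc e with zero-or-deg (x + y)
  ... | inj₁ z = ≈-trans (≈-sym (+-idʳ x)) (≈-trans (+-cong {x} ≈-refl (≈-sym (+-self y)))
                   (≈-trans (≈-sym (+-assoc x y y)) (+-cong z ≈-refl)))
  ... | inj₂ (d , pd) = ⊥-elim (nonZero-* nc (deg⇒nonZero pd)
                          (≈-trans (*-distribˡ c x y) (≈-trans (+-cong e ≈-refl) (+-self (c * y)))))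

  unit⇒≈1 : ∀ {a b} → a * b ≈ 1P → a ≈ 1P
  unit⇒≈1 {a} {b} e with zero-or-deg a | zero-or-deg b
  ... | inj₁ z | _ = ⊥-elim (1≉0 (≈-trans (≈-sym e) (zero-*ˡ z b)))
  ... | inj₂ _ | inj₁ z = ⊥-elim (1≉0 (≈-trans (≈-sym e) (≈-trans (*-congʳ a z) (*-zeroʳ a))))
  ... | inj₂ (da , pa) | inj₂ (db , pb) = degree0 a da pa (sum0 da db (deg-unique (deg-* pa pb) (deg-≈ deg-1 (≈-sym e))))
    where
    sum0 : ∀ da db → da +ℕ db ≡ 0 → da ≡ 0
    sum0 zero db _ = refl
    degree0 : ∀ a da → Deg a da → da ≡ 0 → a ≈ 1P
    degree0 a .zero (t ,ᵈ bb) refl = mk λ { zero → t ; (suc k) → bb (suc k) (s≤s z≤n) }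

  infix 4 _∣_
  record _∣_ (a b : Poly) : Set where
    constructor divides
    field quotient : Poly
          equation : a * quotient ≈ b

  ∣-refl : ∀ {a} → a ∣ a
  ∣-refl {a} = divides 1P (*-idʳ a)

  ∣-≈ : ∀ {a a' b b'} → a ≈ a' → b ≈ b' → a ∣ b → a' ∣ b'
  ∣-≈ {a} {a'} p q (divides k e) = divides k (≈-trans (*-congˡ (≈-sym p) k) (≈-trans e q))

  ∣-trans : ∀ {a b c} → a ∣ b → b ∣ c → a ∣ c
  ∣-trans {a} (divides k e) (divides l f) = divides (k * l) (≈-trans (≈-sym (*-assoc a k l)) (≈-trans (*-congˡ e l) f))

  ∣-+ : ∀ {a b c} → a ∣ b → a ∣ c → a ∣ b + c
  ∣-+ {a} (divides k e) (divides l f) = divides (k + l) (≈-trans (*-distribˡ a k l) (+-cong e f))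

  ∣-*ʳ : ∀ {a b} c → a ∣ b → a ∣ b * c
  ∣-*ʳ {a} c (divides k e) = divides (k * c) (≈-trans (≈-sym (*-assoc a k c)) (*-congˡ e c))

  ∣-*ˡ : ∀ {a b} c → a ∣ b → a ∣ c * b
  ∣-*ˡ {a} {b} c d = ∣-≈ ≈-refl (*-comm b c) (∣-*ʳ c d)

  ∣-0 : ∀ {a} → a ∣ 0P
  ∣-0 {a} = divides 0P (*-zeroʳ a)

  ∣-factor : ∀ a b → a ∣ a * b
  ∣-factor a b = divides b ≈-refl

  1∣ : ∀ a → 1P ∣ a
  1∣ a = divides a (*-idˡ a)

  ∣-cancel+ : ∀ {a b c} → a ∣ b + c → a ∣ c → a ∣ b
  ∣-cancel+ {a} {b} {c} d1 d2 = ∣-≈ ≈-refl (+-twice c b) (∣-+ d1 d2)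

  ∣1⇒≈1 : ∀ {c} → c ∣ 1P → c ≈ 1P
  ∣1⇒≈1 (divides q e) = unit⇒≈1 e

  -- Euclidean division by a polynomial whose coefficients form a vector gv with top coefficient 1.
  -- Remainders are kept as vectors of length n = deg g, which makes their smallness evident.
  module Division where
    open import Data.Vec using (Vec; []; _∷_; toList; replicate)

    topV : ∀ {n} → Vec Bool (suc n) → Bool
    topV (b ∷ []) = b
    topV (b ∷ c ∷ v) = topV (c ∷ v)

    initV : ∀ {n} → Vec Bool (suc n) → Vec Bool n
    initV (b ∷ []) = []
    initV (b ∷ c ∷ v) = b ∷ initV (c ∷ v)

    xorV : ∀ {n} → Vec Bool n → Vec Bool n → Vec Bool n
    xorV [] [] = []
    xorV (a ∷ u) (b ∷ w) = (a xor b) ∷ xorV u w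

    xorV-+ : ∀ {n} (u w : Vec Bool n) → toList (xorV u w) ≈ toList u + toList w
    xorV-+ [] [] = ≈-refl
    xorV-+ (a ∷ u) (b ∷ w) = cons-cong (xorV-+ u w)

    topV-xor : ∀ {n} (u w : Vec Bool (suc n)) → topV (xorV u w) ≡ topV u xor topV w
    topV-xor (a ∷ []) (b ∷ []) = refl
    topV-xor (a ∷ c ∷ u) (b ∷ d ∷ w) = topV-xor (c ∷ u) (d ∷ w)

    initV-top : ∀ {n} (v : Vec Bool (suc n)) → toList v ≈ toList (initV v) + scale (topV v) (monomial n)
    initV-top (b ∷ []) with b
    ... | true = ≈-refl
    ... | false = [false]≈[]
    initV-top (b ∷ c ∷ v) = ≈-trans (cons-cong (initV-top (c ∷ v))) (push b (topV (c ∷ v)))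
      where
      push : ∀ b t → (b ∷ (toList (initV (c ∷ v)) + scale t (monomial _)))
                     ≈ (b ∷ toList (initV (c ∷ v))) + scale t (false ∷ monomial _)
      push b true = mk λ { zero → sym (xor-identityʳ b) ; (suc k) → refl }
      push b false = cons-cong (+-idʳ _)

    replicate-false≈0 : ∀ m → toList (replicate m false) ≈ 0P
    replicate-false≈0 zero = ≈-refl
    replicate-false≈0 (suc m) = ≈-trans (cons-cong (replicate-false≈0 m)) [false]≈[]

    module By {n : ℕ} (gv : Vec Bool (suc n)) (gtop : topV gv ≡ true) where
      G : Poly
      G = toList gv

      -- one step of long division: bring down a coefficient and subtract G if the top bit is set
      step : Bool → Vec Bool n → Vec Bool n
      step b r = if topV (b ∷ r) then initV (xorV (b ∷ r) gv) else initV (b ∷ r)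

      step-correct : ∀ b r → toList (b ∷ r) ≈ toList (step b r) + scale (topV (b ∷ r)) G
      step-correct b r with topV (b ∷ r) in eq
      ... | false = ≈-trans (initV-top (b ∷ r)) (+-cong ≈-refl (≡⇒≈ (cong (λ t → scale t (monomial n)) eq)))
      ... | true = begin
          toList h                           ≈⟨ ≈-sym (+-idʳ _) ⟩
          toList h + 0P                      ≈⟨ +-cong {toList h} ≈-refl (≈-sym (+-self G)) ⟩
          toList h + (G + G)                 ≈⟨ ≈-sym (+-assoc _ G G) ⟩
          (toList h + G) + G                 ≈⟨ +-cong (≈-sym (xorV-+ h gv)) ≈-refl ⟩
          toList (xorV h gv) + G             ≈⟨ +-cong drop-top ≈-refl ⟩
          toList (initV (xorV h gv)) + G     ∎
        where
        open ≈-Reasoning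
        h = b ∷ r
        top-cancels : topV (xorV h gv) ≡ false
        top-cancels = trans (topV-xor h gv) (cong₂ _xor_ eq gtop)
        drop-top : toList (xorV h gv) ≈ toList (initV (xorV h gv))
        drop-top = ≈-trans (initV-top (xorV h gv))
                     (≈-trans (+-cong ≈-refl (≡⇒≈ (cong (λ t → scale t (monomial n)) top-cancels))) (+-idʳ _))

      quotRem : Poly → Poly × Vec Bool n
      quotRem [] = [] , replicate n false
      quotRem (b ∷ f) = topV (b ∷ proj₂ (quotRem f)) ∷ proj₁ (quotRem f) , step b (proj₂ (quotRem f))

      quotRem-correct : ∀ f → f ≈ proj₁ (quotRem f) * G + toList (proj₂ (quotRem f))
      quotRem-correct [] = ≈-sym (replicate-false≈0 n)
      quotRem-correct (b ∷ f) = begin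
          b ∷ f                                              ≈⟨ cons-cong (quotRem-correct f) ⟩
          (false ∷ (q * G)) + (b ∷ toList r)                 ≈⟨ +-cong {false ∷ (q * G)} ≈-refl (step-correct b r) ⟩
          (false ∷ (q * G)) + (toList (step b r) + scale t G)  ≈⟨ rearrange (false ∷ (q * G)) (toList (step b r)) (scale t G) ⟩
          (scale t G + (false ∷ (q * G))) + toList (step b r)  ≈⟨ +-cong (≈-sym (*-consˡ t q G)) ≈-refl ⟩
          (t ∷ q) * G + toList (step b r)                    ∎
        where
        open ≈-Reasoning
        q = proj₁ (quotRem f)
        r = proj₂ (quotRem f)
        t = topV (b ∷ r)
        rearrange : ∀ x r s → x + (r + s) ≈ (s + x) + r
        rearrange = solve-∀ PolySolverRing

  record Gcd (f g : Poly) : Set where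
    constructor gcdR
    field d u v : Poly
          bézout : d ≈ u * f + v * g
          d∣f : d ∣ f
          d∣g : d ∣ g

  -- The Euclidean algorithm, by recursion on a bound N for the length of the normal divisor g.
  gcd-bounded : (N : ℕ) (f g : Poly) → Normal g → length g ≤ N → Gcd f g
  gcd-bounded N f [] _ _ = gcdR f 1P 0P (≈-sym (≈-trans (+-cong (*-idˡ f) (*-zeroʳ 0P)) (+-idʳ f))) ∣-refl ∣-0
  gcd-bounded (suc N) f (c ∷ cs) nc (s≤s le) = gcdR d v (u + v * q) bézout' d∣f' d∣g'
    where
    open import Data.Vec using (Vec; []; _∷_; toList; fromList)
    open import Data.Vec.Properties using (toList∘fromList; length-toList)
    open Division
    g = c ∷ cs
    top-normal : ∀ c cs → Normal (c ∷ cs) → topV (fromList (c ∷ cs)) ≡ true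
    top-normal c [] n = n
    top-normal c (d ∷ ds) n = top-normal d ds n
    open By (fromList g) (top-normal c cs nc)
    length-norm : ∀ v → length (norm v) ≤ length v
    length-norm [] = z≤n
    length-norm (b ∷ bs) with norm bs | length-norm bs
    ... | [] | _ with b
    ...   | true = s≤s z≤n
    ...   | false = z≤n
    length-norm (b ∷ bs) | c ∷ cs | le = s≤s le
    q = proj₁ (quotRem f)
    R = toList (proj₂ (quotRem f))
    f≈qg+R : f ≈ q * g + R
    f≈qg+R = ≈-trans (quotRem-correct f) (+-cong (*-congʳ q (≡⇒≈ (toList∘fromList g))) ≈-refl)
    shorter : length (norm R) ≤ N
    shorter = NP.≤-trans (length-norm R) (subst (_≤ N) (sym (length-toList (proj₂ (quotRem f)))) le)
    open Gcd (gcd-bounded N g (norm R) (norm-normal R) shorter) renaming (d∣f to d∣g'; d∣g to d∣normR)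
    d∣R : d ∣ R
    d∣R = ∣-≈ ≈-refl (norm-≈ R) d∣normR
    d∣f' : d ∣ f
    d∣f' = ∣-≈ ≈-refl (≈-sym f≈qg+R) (∣-+ (∣-*ˡ q d∣g') d∣R)
    R≈f+qg : R ≈ f + q * g
    R≈f+qg = ≈-sym (≈-trans (+-cong (≈-trans f≈qg+R (+-comm (q * g) R)) ≈-refl) (+-twice (q * g) R))
    substitute : ∀ u v f g q → u * g + v * (f + q * g) ≈ v * f + (u + v * q) * g
    substitute = solve-∀ PolySolverRing
    bézout' : d ≈ v * f + (u + v * q) * g
    bézout' = ≈-trans bézout (≈-trans (+-cong {u * g} ≈-refl (*-congʳ v (≈-trans (norm-≈ R) R≈f+qg))) (substitute u v f g q))

  gcd : (f g : Poly) → Gcd f g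
  gcd f g with gcd-bounded (length (norm g)) f (norm g) (norm-normal g) NP.≤-refl
  ... | gcdR d u v b df dg =
    gcdR d u v (≈-trans b (+-cong {u * f} ≈-refl (*-congʳ v (norm-≈ g)))) df (∣-≈ ≈-refl (norm-≈ g) dg)

  norm-length1 : ∀ v → length (norm v) ≡ 1 → v ≈ 1P
  norm-length1 v e with norm v | norm-normal v | norm-≈ v
  norm-length1 v refl | x ∷ [] | refl | p = ≈-sym p

  irreducible-divisor : ∀ {p d} → Irreducible p → d ∣ p → (d ≈ 1P) ⊎ (d ≈ p)
  irreducible-divisor {p} {d} (np , _ , irr) (divides k e) with irr (norm d) (norm k) (norm-normal d) (norm-normal k) normal-product
    where
    normal-product : norm (mulP (norm d) (norm k)) ≡ p
    normal-product = trans (≈⇒norm≡ (≈-trans (*-cong (norm-≈ d) (norm-≈ k)) e)) (norm-id p np)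
  ... | inj₁ l = inj₁ (norm-length1 d l)
  ... | inj₂ l = inj₂ (≈-trans (≈-sym (*-idʳ d)) (≈-trans (*-congʳ d (≈-sym (norm-length1 k l))) e))

  irreducible-prime : ∀ {p a b} → Irreducible p → p ∣ a * b → (p ∣ a) ⊎ (p ∣ b)
  irreducible-prime {p} {a} {b} ip (divides w e) with gcd p a
  ... | gcdR d u v bz dp da with irreducible-divisor ip dp
  ... | inj₂ d≈p = inj₁ (∣-≈ d≈p ≈-refl da)
  ... | inj₁ d≈1 = inj₂ (divides (u * b + v * w) (≈-sym b≈p[ub+vw]))
    where
    expand : ∀ u p v a b → (u * p + v * a) * b ≈ p * (u * b) + v * (a * b)
    expand = solve-∀ PolySolverRing
    collect : ∀ u p v b w → p * (u * b) + v * (p * w) ≈ p * (u * b + v * w)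
    collect = solve-∀ PolySolverRing
    b≈p[ub+vw] : b ≈ p * (u * b + v * w)
    b≈p[ub+vw] = ≈-trans (≈-sym (*-idˡ b)) (≈-trans (*-congˡ (≈-trans (≈-sym d≈1) bz) b)
      (≈-trans (expand u p v a b) (≈-trans (+-cong {p * (u * b)} ≈-refl (*-congʳ v (≈-sym e))) (collect u p v b w))))

  irreducible≉1 : ∀ {c} → Irreducible c → ¬ (c ≈ 1P)
  irreducible≉1 {c} (nc , l2 , _) e with normal-unique c 1P nc refl e
  irreducible≉1 (nc , s≤s () , _) e | refl

  irreducible∤1 : ∀ {c} → Irreducible c → ¬ (c ∣ 1P)
  irreducible∤1 ic d = irreducible≉1 ic (∣1⇒≈1 d)

  irreducible-nonZero : ∀ {c} → Irreducible c → NonZeroP c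
  irreducible-nonZero {[]} (nc , () , _)
  irreducible-nonZero {x ∷ c} (nc , _ , _) = deg⇒nonZero (normal-deg x c nc)

  irreducible∣irreducible : ∀ {c p} → Irreducible c → Irreducible p → c ∣ p → c ≡ p
  irreducible∣irreducible {c} {p} ic ip d with irreducible-divisor ip d
  ... | inj₁ c≈1 = ⊥-elim (irreducible≉1 ic c≈1)
  ... | inj₂ c≈p = normal-unique c p (proj₁ ic) (proj₁ ip) c≈p

  pow : Poly → ℕ → Poly
  pow a zero = 1P
  pow a (suc n) = a * pow a n

  pow-cong : ∀ {a b} n → a ≈ b → pow a n ≈ pow b n
  pow-cong zero p = ≈-refl
  pow-cong (suc n) p = *-cong p (pow-cong n p)

  pow-+ : ∀ a m n → pow a (m +ℕ n) ≈ pow a m * pow a n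
  pow-+ a zero n = ≈-sym (*-idˡ _)
  pow-+ a (suc m) n = ≈-trans (*-congʳ a (pow-+ a m n)) (≈-sym (*-assoc a (pow a m) (pow a n)))

  pow-* : ∀ a m n → pow a (m *ℕ n) ≈ pow (pow a m) n
  pow-* a m zero rewrite NP.*-zeroʳ m = ≈-refl
  pow-* a m (suc n) rewrite NP.*-suc m n = ≈-trans (pow-+ a m (m *ℕ n)) (*-congʳ (pow a m) (pow-* a m n))

  pow-distrib : ∀ a b n → pow (a * b) n ≈ pow a n * pow b n
  pow-distrib a b zero = ≈-sym (*-idˡ 1P)
  pow-distrib a b (suc n) = ≈-trans (*-congʳ (a * b) (pow-distrib a b n)) (interchange a b (pow a n) (pow b n))
    where
    interchange : ∀ a b c d → (a * b) * (c * d) ≈ (a * c) * (b * d)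
    interchange = solve-∀ PolySolverRing

  pow-∣-pow : ∀ p {a b} → a ≤ b → pow p a ∣ pow p b
  pow-∣-pow p {a} le with NP.m≤n⇒∃[o]m+o≡n le
  ... | k , refl = divides (pow p k) (≈-sym (pow-+ p a k))

  ∣⇒pow∣pow : ∀ {u v} n → u ∣ v → pow u n ∣ pow v n
  ∣⇒pow∣pow {u} {v} n (divides k ek) = divides (pow k n) (≈-trans (≈-sym (pow-distrib u k n)) (pow-cong n ek))

  ∣⇒∣pow : ∀ {u v} A → 1 ≤ A → u ∣ v → u ∣ pow v A
  ∣⇒∣pow (suc A) _ d = ∣-*ʳ _ d

  irreducible∣pow : ∀ {c u} n → Irreducible c → c ∣ pow u n → c ∣ u
  irreducible∣pow zero ic d = ⊥-elim (irreducible∤1 ic d)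
  irreducible∣pow {c} {u} (suc n) ic d with irreducible-prime {c} {u} ic d
  ... | inj₁ x = x
  ... | inj₂ y = irreducible∣pow n ic y

  pow-nonZero : ∀ {c} n → NonZeroP c → NonZeroP (pow c n)
  pow-nonZero zero nz = 1≉0
  pow-nonZero (suc n) nz = nonZero-* nz (pow-nonZero n nz)

  shift≈X* : ∀ w → (false ∷ w) ≈ X * w
  shift≈X* w = ≈-sym (cons-cong (*-idˡ w))

  monomial≈pow : ∀ n → monomial n ≈ pow X n
  monomial≈pow zero = ≈-refl
  monomial≈pow (suc n) = ≈-trans (shift≈X* (monomial n)) (*-congʳ X (monomial≈pow n))

  monomial-+ : ∀ m n → monomial (m +ℕ n) ≈ monomial m * monomial n
  monomial-+ m n = ≈-trans (monomial≈pow (m +ℕ n))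
    (≈-trans (pow-+ X m n) (≈-sym (*-cong (monomial≈pow m) (monomial≈pow n))))

  monomial-* : ∀ m n → monomial (m *ℕ n) ≈ pow (monomial m) n
  monomial-* m n = ≈-trans (monomial≈pow (m *ℕ n)) (≈-trans (pow-* X m n) (pow-cong n (≈-sym (monomial≈pow m))))

  monomial-injective : ∀ {m n} → monomial m ≈ monomial n → m ≡ n
  monomial-injective {m} {n} e = sym (position n m (trans (sym (at e m)) (top m)))
    where
    position : ∀ n k → coeff (monomial n) k ≡ true → n ≡ k
    position zero zero e = refl
    position (suc n) (suc k) e = cong suc (position n k e)
    top : ∀ n → coeff (monomial n) n ≡ true
    top zero = refl
    top (suc n) = top n

  E : ℕ → Poly
  E n = monomial n + 1P

  E0≈0 : E 0 ≈ 0P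
  E0≈0 = +-self 1P

  E1≈x+1 : E 1 ≈ x+1
  E1≈x+1 = mk λ { zero → refl ; (suc zero) → refl ; (suc (suc k)) → refl }

  E-injective : ∀ {m n} → E m ≈ E n → m ≡ n
  E-injective {m} {n} e = monomial-injective (≈-trans (≈-sym (+-twice 1P (monomial m))) (≈-trans (+-cong e ≈-refl) (+-twice 1P (monomial n))))

  E-+ : ∀ a b → E (a +ℕ b) ≈ monomial a * E b + E a
  E-+ a b = ≈-trans (+-cong (monomial-+ a b) ≈-refl) (≈-sym (≈-trans (regroup (monomial a) (monomial b)) (+-twice (monomial a) _)))
    where
    regroup : ∀ x y → x * (y + 1P) + (x + 1P) ≈ ((x * y + 1P) + x) + x
    regroup = solve-∀ PolySolverRing

  -- The set of n with c ∣ E n is closed under +, -, multiples, hence under gcd.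
  E-add : ∀ {c a b} → c ∣ E a → c ∣ E b → c ∣ E (a +ℕ b)
  E-add {c} {a} {b} da db = ∣-≈ ≈-refl (≈-sym (E-+ a b)) (∣-+ (∣-*ˡ (monomial a) db) da)

  E-sub : ∀ {c a b} → c ∣ E (a +ℕ b) → c ∣ E b → c ∣ E a
  E-sub {c} {a} {b} dab db =
    ∣-cancel+ (∣-≈ ≈-refl (≈-trans (E-+ a b) (+-comm (monomial a * E b) (E a))) dab) (∣-*ˡ (monomial a) db)

  E-mul : ∀ {c a} k → c ∣ E a → c ∣ E (k *ℕ a)
  E-mul zero d = ∣-≈ ≈-refl (≈-sym E0≈0) ∣-0
  E-mul (suc k) d = E-add d (E-mul k d)

  E-∣ : ∀ {c a b} → c ∣ E a → a ND.∣ b → c ∣ E b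
  E-∣ d (ND.divides k refl) = E-mul k d

  E-∣-E : ∀ {a b} → a ND.∣ b → E a ∣ E b
  E-∣-E d = E-∣ ∣-refl d

  E-bézout : ∀ {c d a b} → c ∣ E a → c ∣ E b → Bézout.Identity d a b → c ∣ E d
  E-bézout {c} {d} {a} {b} da db (Bézout.+- x y eq) =
    E-sub {c} {d} {y *ℕ b} (subst (λ z → c ∣ E z) (sym eq) (E-mul x da)) (E-mul y db)
  E-bézout {c} {d} {a} {b} da db (Bézout.-+ x y eq) =
    E-sub {c} {d} {x *ℕ a} (subst (λ z → c ∣ E z) (sym eq) (E-mul y db)) (E-mul x da)

  E-gcd : ∀ {c a b} → c ∣ E a → c ∣ E b → Σ ℕ λ d → GCD a b d × c ∣ E d
  E-gcd {a = a} {b} da db with Bézout.lemma a b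
  ... | Bézout.result d g bz = d , g , E-bézout da db bz

  x+1∣E : ∀ n → x+1 ∣ E n
  x+1∣E n = ∣-≈ E1≈x+1 ≈-refl (E-∣ {E 1} ∣-refl (ND.1∣ n))

  E-frobenius : ∀ n s → pow (E n) (2 ^ s) ≈ E (n *ℕ 2 ^ s)
  E-frobenius n zero rewrite NP.*-identityʳ n = *-idʳ (E n)
  E-frobenius n (suc s) = begin
      pow (E n) (2 ^ s +ℕ (2 ^ s +ℕ 0))            ≈⟨ pow-+ (E n) (2 ^ s) (2 ^ s +ℕ 0) ⟩
      pow (E n) (2 ^ s) * pow (E n) (2 ^ s +ℕ 0)    ≈⟨ *-cong (E-frobenius n s) (≡⇒≈ (cong (pow (E n)) (NP.+-identityʳ (2 ^ s)))) ⟩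
      E N * pow (E n) (2 ^ s)                       ≈⟨ *-congʳ (E N) (E-frobenius n s) ⟩
      E N * E N                                     ≈⟨ square-sum (monomial N) 1P ⟩
      monomial N * monomial N + 1P * 1P             ≈⟨ +-cong (≈-sym (monomial-+ N N)) (*-idˡ 1P) ⟩
      E (N +ℕ N)                                    ≡⟨ cong E (double n (2 ^ s)) ⟩
      E (n *ℕ 2 ^ suc s)                            ∎
    where
    open ≈-Reasoning
    N = n *ℕ 2 ^ s
    square-sum : ∀ u v → (u + v) * (u + v) ≈ u * u + v * v
    square-sum u v = ≈-trans (expand u v) (+-twice (u * v) _)
      where
      expand : ∀ u v → (u + v) * (u + v) ≈ ((u * u + v * v) + u * v) + u * v
      expand = solve-∀ PolySolverRing
    double : ∀ a b → a *ℕ b +ℕ a *ℕ b ≡ a *ℕ (2 *ℕ b)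
    double a b = solve 2 (λ a b → a :* b :+ a :* b := a :* (con 2 :* b)) refl a b
      where open import Data.Nat.Solver using (module +-*-Solver)
            open +-*-Solver

  ∣P⇒∣ : ∀ {f g} → f ∣P g → f ∣ g
  ∣P⇒∣ (q , e) = divides q (norm≡⇒≈ e)

  ∣⇒∣P : ∀ {f g} → f ∣ g → f ∣P g
  ∣⇒∣P (divides q e) = q , ≈⇒norm≡ e

  ∣P-xe-1⇒∣E : ∀ {f n} → f ∣P xe-1 n → f ∣ E n
  ∣P-xe-1⇒∣E {n = n} d = ∣-≈ ≈-refl (norm-≈ (E n)) (∣P⇒∣ d)

  ∣E⇒∣P-xe-1 : ∀ {f n} → f ∣ E n → f ∣P xe-1 n
  ∣E⇒∣P-xe-1 {n = n} d = ∣⇒∣P (∣-≈ ≈-refl (≈-sym (norm-≈ (E n))) d)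

  period-∣E : ∀ {c m} → HasPeriod c m → c ∣ E m
  period-∣E {c} (_ , c∣ , _) = ∣P-xe-1⇒∣E {c} c∣

  -- The period divides every n with c ∣ xⁿ + 1 (the gcd of two such n is again such an n).
  period-∣ : ∀ {c m n} → HasPeriod c m → c ∣ E n → m ND.∣ n
  period-∣ {c} {m} {n} (m>0 , cm , minimal) cn with E-gcd (∣P-xe-1⇒∣E cm) cn
  ... | d , gd , cd with NP.<-cmp d m
  ... | tri≈ _ refl _ = GCD.gcd∣n gd
  ... | tri> _ _ gt = ⊥-elim (NP.<⇒≱ gt (ND.∣⇒≤ ⦃ ℕ.>-nonZero m>0 ⦄ (GCD.gcd∣m gd)))
  ... | tri< lt _ _ = ⊥-elim (minimal d (positive d (GCD.gcd∣m gd)) lt (∣E⇒∣P-xe-1 cd))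
    where
    positive : ∀ d → d ND.∣ m → 0 < d
    positive zero dm = ⊥-elim (NP.<⇒≢ m>0 (sym (ND.0∣⇒≡0 dm)))
    positive (suc _) _ = s≤s z≤n

  period-unique : ∀ {c m m'} → HasPeriod c m → HasPeriod c m' → m ≡ m'
  period-unique {c} pm pm' = ND.∣-antisym (period-∣ {c} pm (period-∣E {c} pm')) (period-∣ {c} pm' (period-∣E {c} pm))

  ∣E⇒constOne : ∀ {f n} → f ∣ E n → 0 < n → ConstOne (norm f)
  ∣E⇒constOne {f} {n} d n>0 with norm f | at (norm-≈ f) 0 | coeff0 f d n>0
    where
    X≉1 : ¬ (X ≈ 1P)
    X≉1 e with at e 0
    ... | ()
    coeff0 : ∀ f {n} → f ∣ E n → 0 < n → coeff f 0 ≡ true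
    coeff0 [] (divides q eq) n>0 = ⊥-elim (NP.<⇒≢ n>0 (sym (E-injective (≈-trans (≈-sym eq) (≈-sym E0≈0)))))
    coeff0 (true ∷ f) d n>0 = refl
    coeff0 (false ∷ f) {suc n} d n>0 = ⊥-elim (X≉1 (∣1⇒≈1 X∣1))
      where
      -- x ∣ f and x ∣ x^(n+1), so x ∣ 1
      X∣1 : X ∣ 1P
      X∣1 = ∣-cancel+ (∣-≈ ≈-refl (+-comm (monomial (suc n)) 1P) (∣-trans (divides f (≈-sym (shift≈X* f))) d))
                      (divides (monomial n) (≈-sym (shift≈X* (monomial n))))
  ... | [] | e | c = ⊥-elim (false≢true (trans e c))
    where
    false≢true : false ≢ true
    false≢true ()
  ... | b ∷ _ | e | c = trans e c

  geo : Poly → ℕ → Poly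
  geo y zero = 0P
  geo y (suc n) = 1P + y * geo y n

  geo-telescopes : ∀ y n → (y + 1P) * geo y n ≈ pow y n + 1P
  geo-telescopes y zero = ≈-trans (*-zeroʳ (y + 1P)) (≈-sym (+-self 1P))
  geo-telescopes y (suc n) = begin
      (y + 1P) * (1P + y * geo y n)            ≈⟨ distribute y (geo y n) ⟩
      (y + 1P) + y * ((y + 1P) * geo y n)      ≈⟨ +-cong {y + 1P} ≈-refl (*-congʳ y (geo-telescopes y n)) ⟩
      (y + 1P) + y * (pow y n + 1P)            ≈⟨ collect y (pow y n) ⟩
      ((y * pow y n + 1P) + y) + y             ≈⟨ +-twice y _ ⟩
      pow y (suc n) + 1P                       ∎
    where
    open ≈-Reasoning
    distribute : ∀ y G → (y + 1P) * (1P + y * G) ≈ (y + 1P) + y * ((y + 1P) * G)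
    distribute = solve-∀ PolySolverRing
    collect : ∀ y P → (y + 1P) + y * (P + 1P) ≈ ((y * P + 1P) + y) + y
    collect = solve-∀ PolySolverRing

  -- Modulo c ∣ y + 1 each term of geo y n is 1, so geo y n ≡ n mod c; for odd n this is 1.
  geo-odd-coprime : ∀ {c y n} → Odd n → c ∣ y + 1P → c ∣ geo y n → c ∣ 1P
  geo-odd-coprime {c} {y} {n} (k , refl) c∣y+1 c∣geo = ∣-cancel+ c∣1+geo c∣geo
    where
    parity : ℕ → Poly
    parity zero = 0P
    parity (suc n) = 1P + parity n
    parity-odd : ∀ k → parity (suc (k *ℕ 2)) ≈ 1P
    parity-odd zero = +-idʳ 1P
    parity-odd (suc k) = ≈-trans (≈-sym (+-assoc 1P 1P (parity (suc (k *ℕ 2)))))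
                           (≈-trans (+-cong (+-self 1P) ≈-refl) (parity-odd k))
    geo≡parity : ∀ n → c ∣ geo y n + parity n
    geo≡parity zero = ∣-≈ ≈-refl (≈-sym (+-idʳ 0P)) ∣-0
    geo≡parity (suc n) = ∣-≈ ≈-refl (≈-sym (cancel-doubles (y * P) 1P (regroup y (geo y n) P)))
                          (∣-+ (∣-*ˡ y (geo≡parity n)) (∣-*ʳ P c∣y+1))
      where
      P = parity n
      regroup : ∀ y G P → (1P + y * G) + (1P + P) + (y * P + y * P) ≈ (y * (G + P) + (y + 1P) * P) + (1P + 1P)
      regroup = solve-∀ PolySolverRing
    c∣1+geo : c ∣ 1P + geo y n
    c∣1+geo = ∣-≈ ≈-refl (≈-trans (+-cong {geo y n} ≈-refl (parity-odd k)) (+-comm (geo y n) 1P)) (geo≡parity n)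

  -- Ψ m e = (x^(mᵉ) + 1)/(x^(m^(e-1)) + 1) for e ≥ 2, and Ψ m e = 1 for e ≤ 1.  It is the part of
  -- x^(mᵉ) + 1 responsible for the exponent e of m in a period.
  Ψ : ℕ → ℕ → Poly
  Ψ m zero = 1P
  Ψ m (suc zero) = 1P
  Ψ m (suc (suc e)) = geo (monomial (m ^ suc e)) m

  Ψ-factor : ∀ m e → E (m ^ suc e) * Ψ m (suc (suc e)) ≈ E (m ^ suc (suc e))
  Ψ-factor m e = ≈-trans (geo-telescopes y m) (≈-trans (+-cong (≈-sym (monomial-* k m)) ≈-refl) (≡⇒≈ (cong E (NP.*-comm k m))))
    where
    k = m ^ suc e
    y = monomial k

  Ψ∣E : ∀ m e → Ψ m e ∣ E (m ^ e)
  Ψ∣E m zero = 1∣ _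
  Ψ∣E m (suc zero) = 1∣ _
  Ψ∣E m (suc (suc e)) = divides (E (m ^ suc e)) (≈-trans (*-comm (Ψ m (suc (suc e))) (E (m ^ suc e))) (Ψ-factor m e))

  irreducible∤Ψ : ∀ {c} m e → Irreducible c → c ∣ E m → Odd m → ¬ (c ∣ Ψ m e)
  irreducible∤Ψ m zero ic _ _ d = irreducible∤1 ic d
  irreducible∤Ψ m (suc zero) ic _ _ d = irreducible∤1 ic d
  irreducible∤Ψ m (suc (suc e)) ic cm o d = irreducible∤1 ic (geo-odd-coprime o (E-∣ cm (ND.∣m⇒∣m*n _ ND.∣-refl)) d)

  Ψ∤E-pred : ∀ m e → 2 ≤ m → Odd m → ¬ (Ψ m (suc (suc e)) ∣ E (m ^ suc e))
  Ψ∤E-pred m e m≥2 o d = km≢k (E-injective (begin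
      E (k *ℕ m)             ≡⟨ cong E (NP.*-comm k m) ⟩
      E (m ^ suc (suc e))    ≈⟨ ≈-sym (Ψ-factor m e) ⟩
      E k * Ψ m (suc (suc e)) ≈⟨ *-congʳ (E k) Ψ≈1 ⟩
      E k * 1P               ≈⟨ *-idʳ (E k) ⟩
      E k                    ∎))
    where
    open ≈-Reasoning
    k = m ^ suc e
    -- Ψ divides x^k + 1 and is ≡ m ≡ 1 modulo it, hence is a unit
    Ψ≈1 : Ψ m (suc (suc e)) ≈ 1P
    Ψ≈1 = ∣1⇒≈1 (geo-odd-coprime o d ∣-refl)
    k≥1 : 1 ≤ k
    k≥1 = NP.m^n>0 m ⦃ ℕ.>-nonZero (NP.≤-trans (s≤s z≤n) m≥2) ⦄ (suc e)
    km≢k : k *ℕ m ≢ k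
    km≢k e' = NP.<⇒≢ (NP.*-monoʳ-< k ⦃ ℕ.>-nonZero k≥1 ⦄ m≥2) (trans (NP.*-identityʳ k) (sym e'))

  Ψ-nonZero : ∀ m e → 2 ≤ m → NonZeroP (Ψ m e)
  Ψ-nonZero m e m≥2 z with Ψ∣E m e
  ... | divides q eq = NP.<⇒≢ positive (sym (E-injective (≈-trans (≈-sym eq) (≈-trans (zero-*ˡ z q) (≈-sym E0≈0)))))
    where
    positive : 0 < m ^ e
    positive = NP.m^n>0 m ⦃ ℕ.>-nonZero (NP.≤-trans (s≤s z≤n) m≥2) ⦄ e

  -- The formal derivative D, via the even and odd parts of a coefficient list.
  mutual
    evens : Poly → Poly
    evens [] = []
    evens (c ∷ f) = c ∷ odds f

    odds : Poly → Poly
    odds [] = []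
    odds (c ∷ f) = false ∷ evens f

  D : Poly → Poly
  D [] = []
  D (b ∷ f) = evens f

  mutual
    evens-+ : ∀ f g → evens (f + g) ≈ evens f + evens g
    evens-+ [] g = ≈-refl
    evens-+ (a ∷ f) [] = ≈-sym (+-idʳ _)
    evens-+ (a ∷ f) (b ∷ g) = cons-cong (odds-+ f g)

    odds-+ : ∀ f g → odds (f + g) ≈ odds f + odds g
    odds-+ [] g = ≈-refl
    odds-+ (a ∷ f) [] = ≈-sym (+-idʳ _)
    odds-+ (a ∷ f) (b ∷ g) = cons-cong (evens-+ f g)

  mutual
    evens-0 : ∀ f → f ≈ 0P → evens f ≈ 0P
    evens-0 [] z = ≈-refl
    evens-0 (c ∷ f) z with at z zero
    ... | refl = ≈-trans (cons-cong (odds-0 f (mk λ k → at z (suc k)))) [false]≈[]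

    odds-0 : ∀ f → f ≈ 0P → odds f ≈ 0P
    odds-0 [] z = ≈-refl
    odds-0 (c ∷ f) z = ≈-trans (cons-cong (evens-0 f (mk λ k → at z (suc k)))) [false]≈[]

  evens+odds : ∀ w → odds w + evens w ≈ w
  evens+odds [] = ≈-refl
  evens+odds (c ∷ w) = cons-cong (≈-trans (+-comm (evens w) (odds w)) (evens+odds w))

  D-+ : ∀ f g → D (f + g) ≈ D f + D g
  D-+ [] g = ≈-refl
  D-+ (a ∷ f) [] = ≈-sym (+-idʳ _)
  D-+ (a ∷ f) (b ∷ g) = evens-+ f g

  D-cong : ∀ {f g} → f ≈ g → D f ≈ D g
  D-cong {f} {g} e = ≈-trans (≈-sym (+-twice (D g) (D f))) (+-cong Df+Dg≈0 ≈-refl)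
    where
    D-zero : ∀ f → f ≈ 0P → D f ≈ 0P
    D-zero [] z = ≈-refl
    D-zero (c ∷ f) z = evens-0 f (mk λ k → at z (suc k))
    Df+Dg≈0 : D f + D g ≈ 0P
    Df+Dg≈0 = ≈-trans (≈-sym (D-+ f g)) (D-zero (f + g) (≈-trans (+-cong e ≈-refl) (+-self g)))

  D-X* : ∀ w → D (false ∷ w) ≈ w + X * D w
  D-X* [] = ≈-sym (*-zeroʳ X)
  D-X* (c ∷ w) = ≈-trans (cons-cong odds≈w+evens) (≈-trans (mk λ { zero → sym (xor-identityʳ c) ; (suc k) → refl })
                   (+-cong {c ∷ w} ≈-refl (shift≈X* (evens w))))
    where
    odds≈w+evens : odds w ≈ w + evens w
    odds≈w+evens = ≈-trans (≈-sym (+-twice (evens w) (odds w))) (+-cong (evens+odds w) ≈-refl)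

  D-* : ∀ u v → D (u * v) ≈ D u * v + u * D v
  D-* [] v = ≈-refl
  D-* (b ∷ u) v = begin
      D ((b ∷ u) * v)                                         ≈⟨ D-cong (*-consˡ b u v) ⟩
      D (scale b v + (false ∷ (u * v)))                       ≈⟨ D-+ (scale b v) (false ∷ (u * v)) ⟩
      D (scale b v) + D (false ∷ (u * v))                     ≈⟨ +-cong (D-scale b) (D-X* (u * v)) ⟩
      scale b (D v) + (u * v + X * D (u * v))                 ≈⟨ +-cong {scale b (D v)} ≈-refl (+-cong {u * v} ≈-refl (*-congʳ X (D-* u v))) ⟩
      scale b (D v) + (u * v + X * (D u * v + u * D v))       ≈⟨ regroup (scale b (D v)) u v X (D u) (D v) ⟩
      (u + X * D u) * v + (scale b (D v) + X * (u * D v))     ≈⟨ +-cong (*-congˡ (≈-sym (D-X* u)) v) (+-cong {scale b (D v)} ≈-refl (≈-sym (shift≈X* (u * D v)))) ⟩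
      D (false ∷ u) * v + (scale b (D v) + (false ∷ (u * D v)))  ≈⟨ +-cong {D (false ∷ u) * v} ≈-refl (≈-sym (*-consˡ b u (D v))) ⟩
      D (b ∷ u) * v + (b ∷ u) * D v                           ∎
    where
    open ≈-Reasoning
    D-scale : ∀ b → D (scale b v) ≈ scale b (D v)
    D-scale true = ≈-refl
    D-scale false = ≈-refl
    regroup : ∀ S u v X Du Dv → S + (u * v + X * (Du * v + u * Dv)) ≈ (u + X * Du) * v + (S + X * (u * Dv))
    regroup = solve-∀ PolySolverRing

  -- For odd N, D (x^N + 1) = x^(N-1): x^N + 1 has no repeated irreducible factor.
  squarefree : ∀ {c N u} → Irreducible c → Odd N → E N ≈ c * u → ¬ (c ∣ u)
  squarefree {c} {N} {u} ic (k , refl) e (divides w e2) = irreducible∤1 ic c∣1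
    where
    E≈ccw : E N ≈ c * (c * w)
    E≈ccw = ≈-trans e (*-congʳ c (≈-sym e2))
    even-monomial : ∀ k → evens (monomial (k *ℕ 2)) ≈ monomial (k *ℕ 2)
    even-monomial zero = ≈-refl
    even-monomial (suc k) = cons-cong (cons-cong (even-monomial k))
    D-E : D (E N) ≈ monomial (k *ℕ 2)
    D-E = ≈-trans (D-+ (monomial N) 1P) (≈-trans (+-idʳ _) (even-monomial k))
    -- D (c·c·w) = c·c·D w, because D (c·c) = 2·c·D c = 0
    D-square : D (c * (c * w)) ≈ c * (c * D w)
    D-square = ≈-trans (D-* c (c * w)) (≈-trans (+-cong {D c * (c * w)} ≈-refl (*-congʳ c (D-* c w)))
      (≈-trans (expand c w (D c) (D w)) (+-cong (+-self (D c * (c * w))) ≈-refl)))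
      where
      expand : ∀ p w Dp Dw → Dp * (p * w) + p * (Dp * w + p * Dw) ≈ (Dp * (p * w) + Dp * (p * w)) + p * (p * Dw)
      expand = solve-∀ PolySolverRing
    c∣x^N-1 : c ∣ monomial (k *ℕ 2)
    c∣x^N-1 = divides (c * D w) (≈-sym (≈-trans (≈-sym D-E) (≈-trans (D-cong E≈ccw) D-square)))
    c∣1 : c ∣ 1P
    c∣1 = ∣-cancel+ (∣-≈ ≈-refl (+-comm (monomial N) 1P) (divides (c * w) (≈-sym E≈ccw)))
                    (∣-≈ ≈-refl (≈-sym (shift≈X* (monomial (k *ℕ 2)))) (∣-*ˡ X c∣x^N-1))

  high-power∤pow : ∀ {c N} B → Irreducible c → Odd N → c ∣ E N → ¬ (pow c (suc B) ∣ pow (E N) B)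
  high-power∤pow {c} {N} B ic o (divides u eu) (divides k ek) =
    squarefree ic o (≈-sym eu) (irreducible∣pow B ic (divides k ck≈u^B))
    where
    rotate : ∀ c P k → P * (c * k) ≈ (c * P) * k
    rotate = solve-∀ PolySolverRing
    ck≈u^B : c * k ≈ pow u B
    ck≈u^B = *-cancelˡ (pow-nonZero B (irreducible-nonZero ic))
      (≈-trans (rotate c (pow c B) k) (≈-trans ek (≈-trans (pow-cong B (≈-sym eu)) (pow-distrib c u B))))

  exponent-unique : ∀ {c R R'} a a' → Irreducible c → ¬ (c ∣ R) → ¬ (c ∣ R') →
                    pow c a * R ≈ pow c a' * R' → (a ≡ a') × (R ≈ R')
  exponent-unique {c} {R} {R'} zero zero ic nr nr' e = refl , ≈-trans (≈-sym (*-idˡ R)) (≈-trans e (*-idˡ R'))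
  exponent-unique {c} {R} {R'} zero (suc a') ic nr nr' e =
    ⊥-elim (nr (divides (pow c a' * R') (≈-sym (≈-trans (≈-sym (*-idˡ R)) (≈-trans e (*-assoc c (pow c a') R'))))))
  exponent-unique {c} {R} {R'} (suc a) zero ic nr nr' e =
    ⊥-elim (nr' (divides (pow c a * R) (≈-trans (≈-sym (*-assoc c (pow c a) R)) (≈-trans e (*-idˡ R')))))
  exponent-unique {c} {R} {R'} (suc a) (suc a') ic nr nr' e
    with exponent-unique a a' ic nr nr'
           (*-cancelˡ (irreducible-nonZero ic) (≈-trans (≈-sym (*-assoc c (pow c a) R)) (≈-trans e (*-assoc c (pow c a') R'))))
  ... | refl , q = refl , q

  record Coprime (u v : Poly) : Set where
    constructor coprime
    field α β : Poly
          identity : α * u + β * v ≈ 1P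

  coprime-sym : ∀ {u v} → Coprime u v → Coprime v u
  coprime-sym {u} {v} (coprime a b e) = coprime b a (≈-trans (+-comm (b * v) (a * u)) e)

  coprime-*ʳ : ∀ {u v w} → Coprime u v → Coprime u w → Coprime u (v * w)
  coprime-*ʳ {u} {v} {w} (coprime a b e) (coprime a' b' e') =
    coprime (a * a' * u + a * b' * w + b * v * a') (b * b') (≈-trans (expand u v w a b a' b') (≈-trans (*-cong e e') (*-idˡ 1P)))
    where
    expand : ∀ u v w a b a' b' → (a * a' * u + a * b' * w + b * v * a') * u + (b * b') * (v * w) ≈ (a * u + b * v) * (a' * u + b' * w)
    expand = solve-∀ PolySolverRing

  coprime-*ˡ : ∀ {u v w} → Coprime u w → Coprime v w → Coprime (u * v) w
  coprime-*ˡ c1 c2 = coprime-sym (coprime-*ʳ (coprime-sym c1) (coprime-sym c2))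

  coprime-powʳ : ∀ {u v} n → Coprime u v → Coprime u (pow v n)
  coprime-powʳ zero c = coprime 0P 1P (*-idˡ 1P)
  coprime-powʳ (suc n) c = coprime-*ʳ c (coprime-powʳ n c)

  coprime-powˡ : ∀ {u v} n → Coprime u v → Coprime (pow u n) v
  coprime-powˡ n c = coprime-sym (coprime-powʳ n (coprime-sym c))

  coprime-∣ʳ : ∀ {u v w} → Coprime u w → v ∣ w → Coprime u v
  coprime-∣ʳ {u} {v} {w} (coprime a b e) (divides k ek) =
    coprime a (b * k) (≈-trans (+-cong {a * u} ≈-refl (≈-trans (*-assoc b k v) (*-congʳ b (≈-trans (*-comm k v) ek)))) e)

  irreducible-coprime : ∀ {c v} → Irreducible c → ¬ (c ∣ v) → Coprime c v
  irreducible-coprime {c} {v} ic nd with gcd c v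
  ... | gcdR d u w bz dc dv with irreducible-divisor ic dc
  ... | inj₂ d≈c = ⊥-elim (nd (∣-≈ d≈c ≈-refl dv))
  ... | inj₁ d≈1 = coprime u w (≈-trans (≈-sym bz) d≈1)

  coprime-∣-* : ∀ {u v w} → u ∣ w → v ∣ w → Coprime u v → u * v ∣ w
  coprime-∣-* {u} {v} {w} (divides k ek) (divides k' ek') (coprime a b e) = divides (a * k' + b * k) (≈-sym w≈uv[ak'+bk])
    where
    expand : ∀ a u b v w → (a * u + b * v) * w ≈ a * (u * w) + b * (v * w)
    expand = solve-∀ PolySolverRing
    collect : ∀ a u b v k k' → a * (u * (v * k')) + b * (v * (u * k)) ≈ u * v * (a * k' + b * k)
    collect = solve-∀ PolySolverRing
    w≈uv[ak'+bk] : w ≈ u * v * (a * k' + b * k)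
    w≈uv[ak'+bk] = ≈-trans (≈-sym (*-idˡ w)) (≈-trans (*-congˡ (≈-sym e) w) (≈-trans (expand a u b v w)
      (≈-trans (+-cong (*-congʳ a (*-congʳ u (≈-sym ek'))) (*-congʳ b (*-congʳ v (≈-sym ek)))) (collect a u b v k k'))))

  irreducible-x+1 : Irreducible x+1
  irreducible-x+1 = refl , s≤s (s≤s z≤n) , factors
    where
    deg-x+1 : Deg x+1 1
    deg-x+1 = refl ,ᵈ λ { (suc (suc k)) _ → refl ; (suc zero) (s≤s ()) }
    degree-sum1 : ∀ x y → x +ℕ y ≡ 1 → (suc x ≡ 1) ⊎ (suc y ≡ 1)
    degree-sum1 zero y _ = inj₁ refl
    degree-sum1 (suc zero) zero _ = inj₂ refl
    factors : ∀ a b → Normal a → Normal b → norm (mulP a b) ≡ x+1 → (length a ≡ 1) ⊎ (length b ≡ 1)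
    factors [] b na nb ()
    factors (c ∷ as) [] na nb e =
      ⊥-elim (deg⇒nonZero deg-x+1 (≈-trans (≈-sym (norm≡⇒≈ {(c ∷ as) * []} {x+1} e)) (*-zeroʳ (c ∷ as))))
    factors (c ∷ as) (d ∷ bs) na nb e = degree-sum1 (length as) (length bs)
      (deg-unique (deg-* (normal-deg c as na) (normal-deg d bs nb)) (deg-≈ deg-x+1 (≈-sym (norm≡⇒≈ {(c ∷ as) * (d ∷ bs)} {x+1} e))))

module Construction where

  open PrimePowers
  open Polynomials
  open import Data.List using (List; []; _∷_)
  open import Data.Nat using (ℕ; zero; suc; _≤_; _<_; z≤n; s≤s; _∸_; _^_)
    renaming (_+_ to _+ℕ_; _*_ to _*ℕ_)
  import Data.Nat as ℕ
  import Data.Nat.Properties as NP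
  import Data.Nat.Divisibility as ND
  open import Data.Nat.GCD using (GCD)
  open import Data.Nat.Coprimality using (coprime-Bézout)
  open import Data.Nat.Primality using (prime[2])
  open import Data.Fin using (zero; suc)
  open import Data.Empty using (⊥; ⊥-elim)
  open import Data.Unit using (⊤)
  open import Data.Sum using (_⊎_; inj₁; inj₂)
  open import Data.Product using (Σ; _×_; _,_; proj₁)
  open import Relation.Nullary using (¬_; yes; no)

  IrreducibleOfPeriod : ℕ → Poly → Set
  IrreducibleOfPeriod m p = Irreducible p × HasPeriod p m

  -- Choice A r m cs: cs lists, for i = 0 … r-1, an irreducible pᵢ of period mᵢ and an exponent 1 ≤ bᵢ ≤ A.
  Choice : ℕ → (r : ℕ) (m : Fin r → ℕ) → List (Poly × ℕ) → Set
  Choice A zero m [] = ⊤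
  Choice A zero m (_ ∷ _) = ⊥
  Choice A (suc r) m [] = ⊥
  Choice A (suc r) m ((p , b) ∷ cs) = IrreducibleOfPeriod (m zero) p × (1 ≤ b) × (b ≤ A) × Choice A r (λ i → m (suc i)) cs

  oddPart : (r : ℕ) (m e : Fin r → ℕ) → List (Poly × ℕ) → Poly
  oddPart zero m e _ = 1P
  oddPart (suc r) m e [] = 1P
  oddPart (suc r) m e ((p , b) ∷ cs) = (pow p b * Ψ (m zero) (e zero)) * oddPart r (λ i → m (suc i)) (λ i → e (suc i)) cs

  irreducible∣oddPart : ∀ {c} A r m e cs → Choice A r m cs → Irreducible c → c ∣ oddPart r m e cs →
    Σ (Fin r) λ i → Σ Poly λ p → IrreducibleOfPeriod (m i) p × ((c ∣ p) ⊎ (c ∣ Ψ (m i) (e i)))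
  irreducible∣oddPart A zero m e cs v ic d = ⊥-elim (irreducible∤1 ic d)
  irreducible∣oddPart {c} A (suc r) m e ((p , b) ∷ cs) (ip , _ , _ , v) ic d with irreducible-prime {c} ic d
  ... | inj₂ d-rest with irreducible∣oddPart A r (λ i → m (suc i)) (λ i → e (suc i)) cs v ic d-rest
  ...   | i , q , iq , w = suc i , q , iq , w
  irreducible∣oddPart {c} A (suc r) m e ((p , b) ∷ cs) (ip , _ , _ , v) ic d | inj₁ d-head with irreducible-prime {c} ic d-head
  ... | inj₁ c∣p^b = zero , p , ip , inj₁ (irreducible∣pow b ic c∣p^b)
  ... | inj₂ c∣Ψ = zero , p , ip , inj₂ c∣Ψ

  foreign∤oddPart : ∀ {c n} A r m e cs → IrreducibleOfPeriod n c → Prime n → (∀ i → n ≢ m i) →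
    (∀ i → Prime (m i)) → Choice A r m cs → ¬ (c ∣ oddPart r m e cs)
  foreign∤oddPart {c} A r m e cs (ic , pc) pn n≢ pr v d with irreducible∣oddPart A r m e cs v ic d
  ... | i , p , (ip , pp) , inj₁ c∣p with irreducible∣irreducible ic ip c∣p
  ...   | refl = n≢ i (period-unique {c} pc pp)
  foreign∤oddPart {c} A r m e cs (ic , pc) pn n≢ pr v d | i , p , _ , inj₂ c∣Ψ =
    n≢ i (prime∣prime⇒≡ pn (pr i) (prime∣pow⇒∣ (e i) pn (period-∣ {c} pc (∣-trans c∣Ψ (Ψ∣E (m i) (e i))))))

  -- x + 1 (period 1) does not divide the odd part.
  x+1∤oddPart : ∀ A r m e cs → (∀ i → Prime (m i)) → (∀ i → Odd (m i)) → Choice A r m cs → ¬ (x+1 ∣ oddPart r m e cs)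
  x+1∤oddPart A r m e cs pr od v d with irreducible∣oddPart A r m e cs v irreducible-x+1 d
  ... | i , p , (ip , pp) , inj₁ x+1∣p with irreducible∣irreducible irreducible-x+1 ip x+1∣p
  ...   | refl = prime≢1 (pr i) (ND.∣1⇒≡1 (period-∣ {x+1} pp (x+1∣E 1)))
  x+1∤oddPart A r m e cs pr od v d | i , p , _ , inj₂ x+1∣Ψ =
    irreducible∤Ψ (m i) (e i) irreducible-x+1 (x+1∣E (m i)) (od i) x+1∣Ψ

  head∤rest-oddPart : ∀ {r} (m e : Fin (suc r) → ℕ) A → (∀ i → Prime (m i)) → (∀ i → Odd (m i)) → Injective _≡_ _≡_ m →
    ∀ {c} cs → IrreducibleOfPeriod (m zero) c → Choice A r (λ i → m (suc i)) cs →
    ¬ (c ∣ Ψ (m zero) (e zero) * oddPart r (λ i → m (suc i)) (λ i → e (suc i)) cs)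
  head∤rest-oddPart {r} m e A pr od inj {c} cs gc@(ic , pc) v d with irreducible-prime {c} {Ψ (m zero) (e zero)} ic d
  ... | inj₁ c∣Ψ = irreducible∤Ψ (m zero) (e zero) ic (period-∣E {c} pc) (od zero) c∣Ψ
  ... | inj₂ c∣rest = foreign∤oddPart A r (λ i → m (suc i)) (λ i → e (suc i)) cs gc (pr zero)
                        (λ i eq → zero≢suc (inj eq)) (λ i → pr (suc i)) v c∣rest
    where
    zero≢suc : ∀ {i : Fin r} → zero ≢ suc i
    zero≢suc ()

  oddPart-injective : ∀ A r m e cs cs' → (∀ i → Prime (m i)) → (∀ i → Odd (m i)) → Injective _≡_ _≡_ m →
    Choice A r m cs → Choice A r m cs' → oddPart r m e cs ≈ oddPart r m e cs' → cs ≡ cs'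
  oddPart-injective A zero m e [] [] pr od inj v v' eq = refl
  oddPart-injective A (suc r) m e ((p , b) ∷ cs) ((p' , b') ∷ cs') pr od inj (ip@(irr , _) , b≥1 , _ , v) (ip' , _ , _ , v') eq
    with irreducible∣irreducible irr (proj₁ ip') (p∣p' b b≥1 p^b*R≈p'^b'*R')
    where
    R R' : Poly
    R = Ψ (m zero) (e zero) * oddPart r (λ i → m (suc i)) (λ i → e (suc i)) cs
    R' = Ψ (m zero) (e zero) * oddPart r (λ i → m (suc i)) (λ i → e (suc i)) cs'
    p^b*R≈p'^b'*R' : pow p b * R ≈ pow p' b' * R'
    p^b*R≈p'^b'*R' = ≈-trans (≈-sym (*-assoc (pow p b) _ _)) (≈-trans eq (*-assoc (pow p' b') _ _))
    -- p divides p'^b' · R', but not R', so p ∣ p'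
    p∣p' : ∀ b → 1 ≤ b → pow p b * R ≈ pow p' b' * R' → p ∣ p'
    p∣p' (suc b₀) _ e' with irreducible-prime {p} {pow p' b'} irr (divides (pow p b₀ * R) (≈-trans (≈-sym (*-assoc p (pow p b₀) R)) e'))
    ... | inj₁ p∣p'^b' = irreducible∣pow b' irr p∣p'^b'
    ... | inj₂ p∣R' = ⊥-elim (head∤rest-oddPart m e A pr od inj cs' ip v' p∣R')
  ... | refl with exponent-unique b b' irr (head∤rest-oddPart m e A pr od inj cs ip v) (head∤rest-oddPart m e A pr od inj cs' ip v')
                    (≈-trans (≈-sym (*-assoc (pow p b) _ _)) (≈-trans eq (*-assoc (pow p b') _ _)))
  ... | refl , R≈R' with oddPart-injective A r (λ i → m (suc i)) (λ i → e (suc i)) cs cs' (λ i → pr (suc i)) (λ i → od (suc i))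
                           (tail-injective {m = m} inj) v v' (*-cancelˡ (Ψ-nonZero (m zero) (e zero) (prime≥2 (pr zero))) R≈R')
  ... | refl = refl

  -- For each i, the odd part has a divisor w with w ∣ x^(mᵢ^eᵢ) + 1 but w ∤ x^(mᵢ^(eᵢ-1)) + 1:
  -- w = pᵢ if eᵢ = 1 and w = Ψᵢ otherwise.  This forces mᵢ^eᵢ to divide the period.
  period-witness : ∀ A r m e cs → (∀ i → Prime (m i)) → (∀ i → Odd (m i)) → (∀ i → 1 ≤ e i) → Choice A r m cs →
    ∀ i → Σ Poly λ w → (w ∣ oddPart r m e cs) × (w ∣ E (m i ^ e i)) × ¬ (w ∣ E (m i ^ (e i ∸ 1)))
  period-witness A (suc r) m e ((p , b) ∷ cs) pr od ep (_ , _ , _ , v) (suc j)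
    with period-witness A r (λ i → m (suc i)) (λ i → e (suc i)) cs (λ i → pr (suc i)) (λ i → od (suc i)) (λ i → ep (suc i)) v j
  ... | w , w∣rest , w∣E , w∤E = w , ∣-trans w∣rest (∣-*ˡ (pow p b * Ψ (m zero) (e zero)) ∣-refl) , w∣E , w∤E
  period-witness A (suc r) m e ((p , b) ∷ cs) pr od ep ((_ , pp) , b≥1 , _ , v) zero with head-witness (e zero) (ep zero)
    where
    m₀ = m zero
    head-witness : ∀ k → 1 ≤ k → Σ Poly λ w → (w ∣ pow p b * Ψ m₀ k) × (w ∣ E (m₀ ^ k)) × ¬ (w ∣ E (m₀ ^ (k ∸ 1)))
    head-witness (suc zero) _ =
      p , ∣-trans (∣-≈ (*-idʳ p) ≈-refl (pow-∣-pow p b≥1)) (∣-factor (pow p b) _) ,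
      E-∣ (period-∣E {p} pp) (ND.∣m⇒∣m*n 1 ND.∣-refl) ,
      λ d → prime≢1 (pr zero) (ND.∣1⇒≡1 (period-∣ {p} pp d))
    head-witness (suc (suc k)) _ =
      Ψ m₀ (suc (suc k)) , ∣-*ˡ (pow p b) ∣-refl , Ψ∣E m₀ (suc (suc k)) , Ψ∤E-pred m₀ k (prime≥2 (pr zero)) (od zero)
  ... | w , w∣head , w∣E , w∤E = w , ∣-trans w∣head (∣-factor _ _) , w∣E , w∤E

  ExponentAbove : ℕ → List (Poly × ℕ) → Set
  ExponentAbove B [] = ⊥
  ExponentAbove B ((p , b) ∷ cs) = (B < b) ⊎ ExponentAbove B cs

  exponentAbove⇒power∣oddPart : ∀ A B r m e cs → Choice A r m cs → ExponentAbove B cs →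
    Σ (Fin r) λ i → Σ Poly λ p → IrreducibleOfPeriod (m i) p × (pow p (suc B) ∣ oddPart r m e cs)
  exponentAbove⇒power∣oddPart A B (suc r) m e ((p , b) ∷ cs) (ip , _ , _ , v) (inj₁ B<b) =
    zero , p , ip , ∣-trans (pow-∣-pow p B<b) (∣-trans (∣-factor (pow p b) (Ψ (m zero) (e zero))) (∣-factor _ _))
  exponentAbove⇒power∣oddPart A B (suc r) m e ((p , b) ∷ cs) (_ , _ , _ , v) (inj₂ above)
    with exponentAbove⇒power∣oddPart A B r (λ i → m (suc i)) (λ i → e (suc i)) cs v above
  ... | i , q , iq , d = suc i , q , iq , ∣-trans d (∣-*ˡ (pow p b * Ψ (m zero) (e zero)) ∣-refl)

  -- Ψ₀ divides x^(m₀^e₀) + 1, which is coprime to x^M' + 1 for M' prime to m₀, up to the common factor x + 1.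
  Ψ-coprime-rest : ∀ r (m e : Fin (suc r) → ℕ) → (∀ i → Prime (m i)) → (∀ i → Odd (m i)) → Injective _≡_ _≡_ m →
    Coprime (Ψ (m zero) (e zero)) (E (primePowerProd r (λ i → m (suc i)) (λ i → e (suc i))))
  Ψ-coprime-rest r m e pr od inj with gcd (Ψ (m zero) (e zero)) (E (primePowerProd r (λ i → m (suc i)) (λ i → e (suc i))))
  ... | gcdR G u v bz G∣Ψ G∣E with irreducible-divisor irreducible-x+1
         (∣-≈ ≈-refl E1≈x+1 (E-bézout (∣-trans G∣Ψ (Ψ∣E (m zero) (e zero))) G∣E (coprime-Bézout (head-coprime-rest r m e inj pr))))
  ... | inj₁ G≈1 = coprime u v (≈-trans (≈-sym bz) G≈1)
  ... | inj₂ G≈x+1 = ⊥-elim (irreducible∤Ψ (m zero) (e zero) irreducible-x+1 (x+1∣E (m zero)) (od zero) (∣-≈ G≈x+1 ≈-refl G∣Ψ))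

  oddPart∣E^A : ∀ A r m e cs → 1 ≤ A → (∀ i → Prime (m i)) → (∀ i → Odd (m i)) → (∀ i → 1 ≤ e i) → Injective _≡_ _≡_ m →
    Choice A r m cs → oddPart r m e cs ∣ pow (E (primePowerProd r m e)) A
  oddPart∣E^A A zero m e cs A≥1 pr od ep inj v = 1∣ _
  oddPart∣E^A A (suc r) m e ((p , b) ∷ cs) A≥1 pr od ep inj ((ip , pp) , _ , b≤A , v) =
    coprime-∣-* head∣ rest∣ (coprime-∣ʳ (coprime-powʳ A head-coprime-E') IH)
    where
    m₀ = m zero
    e₀ = e zero
    M' = primePowerProd r (λ i → m (suc i)) (λ i → e (suc i))
    M = primePowerProd (suc r) m e
    p∣E₀ : p ∣ E (m₀ ^ e₀)
    p∣E₀ = E-∣ (period-∣E {p} pp) (m∣m^e m₀ e₀ (ep zero))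
    p-coprime-Ψ : Coprime p (Ψ m₀ e₀)
    p-coprime-Ψ = irreducible-coprime ip (irreducible∤Ψ m₀ e₀ ip (period-∣E {p} pp) (od zero))
    -- pᵇ and Ψ₀ are coprime divisors of (x^(m₀^e₀) + 1)^A
    head∣E₀ : pow p b * Ψ m₀ e₀ ∣ pow (E (m₀ ^ e₀)) A
    head∣E₀ = coprime-∣-* (∣-trans (∣⇒pow∣pow b p∣E₀) (pow-∣-pow (E (m₀ ^ e₀)) b≤A)) (∣⇒∣pow A A≥1 (Ψ∣E m₀ e₀))
                (coprime-powˡ b p-coprime-Ψ)
    head∣ : pow p b * Ψ m₀ e₀ ∣ pow (E M) A
    head∣ = ∣-trans head∣E₀ (∣⇒pow∣pow A (E-∣-E (ND.∣m⇒∣m*n M' ND.∣-refl)))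
    IH : oddPart r (λ i → m (suc i)) (λ i → e (suc i)) cs ∣ pow (E M') A
    IH = oddPart∣E^A A r (λ i → m (suc i)) (λ i → e (suc i)) cs A≥1 (λ i → pr (suc i)) (λ i → od (suc i)) (λ i → ep (suc i))
           (tail-injective {m = m} inj) v
    rest∣ : oddPart r (λ i → m (suc i)) (λ i → e (suc i)) cs ∣ pow (E M) A
    rest∣ = ∣-trans IH (∣⇒pow∣pow A (E-∣-E (ND.∣n⇒∣m*n (m₀ ^ e₀) ND.∣-refl)))
    -- the head factor is coprime to x^M' + 1, hence to the rest
    head-coprime-E' : Coprime (pow p b * Ψ m₀ e₀) (E M')
    head-coprime-E' = coprime-*ˡ (coprime-powˡ b (irreducible-coprime ip (λ d → head∤rest r m e inj pr (period-∣ {p} pp d))))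
                                 (Ψ-coprime-rest r m e pr od inj)

  module Candidates (r : ℕ) (m e : Fin r → ℕ) (t : ℕ) (pr : ∀ i → Prime (m i)) (od : ∀ i → Odd (m i))
                    (ep : ∀ i → 1 ≤ e i) (inj : Injective _≡_ _≡_ m) where

    M A B T : ℕ
    M = primePowerProd r m e
    A = 2 ^ t
    B = 2 ^ (t ∸ 1)
    T = M *ℕ A

    M-odd : Odd M
    M-odd = odd-primePowerProd r m e od

    M>0 : 0 < M
    M>0 with M-odd
    ... | k , eq rewrite eq = s≤s z≤n

    instance
      M-nonZero : ℕ.NonZero M
      M-nonZero = ℕ.>-nonZero M>0

    A≥1 : 1 ≤ A
    A≥1 = NP.m^n>0 2 t

    T>0 : 0 < T
    T>0 = NP.*-mono-< M>0 A≥1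

    candidate : ℕ → List (Poly × ℕ) → Poly
    candidate a cs = pow x+1 a * oddPart r m e cs

    -- (x+1)^a and the odd part are coprime divisors of (x^M + 1)^A = xᵀ + 1.
    candidate∣E-T : ∀ a cs → a ≤ A → Choice A r m cs → candidate a cs ∣ E T
    candidate∣E-T a cs a≤A v = ∣-≈ ≈-refl (E-frobenius M t) (coprime-∣-* x+1-part odd-part coprime-parts)
      where
      x+1-part : pow x+1 a ∣ pow (E M) A
      x+1-part = ∣-trans (∣⇒pow∣pow a (x+1∣E M)) (pow-∣-pow (E M) a≤A)
      odd-part : oddPart r m e cs ∣ pow (E M) A
      odd-part = oddPart∣E^A A r m e cs A≥1 pr od ep inj v
      coprime-parts : Coprime (pow x+1 a) (oddPart r m e cs)
      coprime-parts = coprime-powˡ a (irreducible-coprime irreducible-x+1 (x+1∤oddPart A r m e cs pr od v))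

    M∣ : ∀ a cs g → Choice A r m cs → candidate a cs ∣ E g → M ND.∣ g
    M∣ a cs g v F∣Eg = primePowerProd∣ r m e inj pr prime-power∣
      where
      prime-power∣ : ∀ i → m i ^ e i ND.∣ g
      prime-power∣ i with period-witness A r m e cs pr od ep v i
      ... | w , w∣oddPart , w∣E , w∤E with E-gcd (∣-trans (∣-trans w∣oddPart (∣-*ˡ (pow x+1 a) ∣-refl)) F∣Eg) w∣E
      ... | h , gcd-h , w∣Eh with h NP.≟ m i ^ e i
      ...   | yes refl = GCD.gcd∣m gcd-h
      ...   | no h≢ = ⊥-elim (w∤E (E-∣ w∣Eh (lower (e i) (ep i) (GCD.gcd∣n gcd-h) h≢)))
        where
        lower : ∀ k → 1 ≤ k → h ND.∣ m i ^ k → h ≢ m i ^ k → h ND.∣ m i ^ (k ∸ 1)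
        lower (suc k) _ = proper∣pow⇒∣pred k (pr i)

    Exceeds : ℕ → List (Poly × ℕ) → Set
    Exceeds a cs = 0 < t → (B < a) ⊎ ExponentAbove B cs

    high-power∣candidate : ∀ a cs → Choice A r m cs → (B < a) ⊎ ExponentAbove B cs →
      Σ Poly λ c → Irreducible c × (c ∣ E M) × (pow c (suc B) ∣ candidate a cs)
    high-power∣candidate a cs v (inj₁ B<a) =
      x+1 , irreducible-x+1 , x+1∣E M , ∣-trans (pow-∣-pow x+1 B<a) (∣-factor _ _)
    high-power∣candidate a cs v (inj₂ above) with exponentAbove⇒power∣oddPart A B r m e cs v above
    ... | i , p , (ip , pp) , d =
      p , ip , E-∣ (period-∣E {p} pp) (ND.∣-trans (m∣m^e (m i) (e i) (ep i)) (factor∣prodFin r (λ i → m i ^ e i) i)) ,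
      ∣-trans d (∣-*ˡ (pow x+1 a) ∣-refl)

    -- Minimality of T: a smaller d with candidate ∣ x^d + 1 leads, through g = gcd (d, T), to
    -- candidate ∣ x^(M·B) + 1 = (x^M + 1)^B, impossible because of the factor c^(B+1).
    candidate-minimal : ∀ a cs → a ≤ A → Choice A r m cs → Exceeds a cs → ∀ d → 0 < d → d < T → ¬ (candidate a cs ∣ E d)
    candidate-minimal a cs a≤A v exceeds d d>0 d<T F∣Ed = via-gcd (E-gcd F∣Ed (candidate∣E-T a cs a≤A v))
      where
      via-gcd : (Σ ℕ λ g → GCD d T g × (candidate a cs ∣ E g)) → ⊥
      via-gcd (g , gcd-g , F∣Eg) =
        let t>0 , g∣MB = multiple∣proper⇒∣pred M t prime[2] (M∣ a cs g v F∣Eg) (GCD.gcd∣n gcd-g) g≢T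
            c , ic , c∣EM , c^B+1∣F = high-power∣candidate a cs v (exceeds t>0)
        in high-power∤pow B ic M-odd c∣EM (∣-trans c^B+1∣F (∣-≈ ≈-refl (≈-sym (E-frobenius M (t ∸ 1))) (E-∣ F∣Eg g∣MB)))
        where
        g≢T : g ≢ T
        g≢T g≡T = NP.<-irrefl g≡T (NP.≤-<-trans (ND.∣⇒≤ ⦃ ℕ.>-nonZero d>0 ⦄ (GCD.gcd∣m gcd-g)) d<T)

    Admissible : ℕ × List (Poly × ℕ) → Set
    Admissible (a , cs) = (1 ≤ a) × (a ≤ A) × Choice A r m cs × Exceeds a cs

    Wanted : Poly → Set
    Wanted f = ConstOne f × (x+1 ∣P f) × HasPeriod f T

    polynomial : ℕ × List (Poly × ℕ) → Poly
    polynomial (a , cs) = norm (candidate a cs)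

    polynomial-wanted : ∀ {x} → Admissible x → Normal (polynomial x) × Wanted (polynomial x)
    polynomial-wanted {a , cs} (a≥1 , a≤A , v , exceeds) = norm-normal F , ∣E⇒constOne F∣E T>0 , x+1∣F , period
      where
      F = candidate a cs
      F∣E : F ∣ E T
      F∣E = candidate∣E-T a cs a≤A v
      x+1∣F : x+1 ∣P norm F
      x+1∣F = ∣⇒∣P (∣-≈ ≈-refl (≈-sym (norm-≈ F)) (∣-trans (∣-≈ (*-idʳ x+1) ≈-refl (pow-∣-pow x+1 a≥1)) (∣-factor _ _)))
      period : HasPeriod (norm F) T
      period = T>0 , ∣E⇒∣P-xe-1 (∣-≈ (≈-sym (norm-≈ F)) ≈-refl F∣E) ,
               λ d d>0 d<T F∣P → candidate-minimal a cs a≤A v exceeds d d>0 d<T (∣-≈ (norm-≈ F) ≈-refl (∣P-xe-1⇒∣E F∣P))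

    polynomial-injective : ∀ {x y} → Admissible x → Admissible y → polynomial x ≡ polynomial y → x ≡ y
    polynomial-injective {a , cs} {a' , cs'} (_ , _ , v , _) (_ , _ , v' , _) eq
      with exponent-unique a a' irreducible-x+1 (x+1∤oddPart A r m e cs pr od v) (x+1∤oddPart A r m e cs' pr od v') (norm≡⇒≈ eq)
    ... | refl , odd≈odd' with oddPart-injective A r m e cs cs' pr od inj v v' odd≈odd'
    ... | refl = refl

module ListFacts where

  open import Data.List using (List; []; _∷_; length; map; _++_; applyUpTo; cartesianProductWith)
  open import Data.List.Properties using (length-++; length-map; length-applyUpTo)
  open import Data.List.Relation.Unary.All as All using (All; []; _∷_)
  import Data.List.Relation.Unary.All.Properties as AllP
  open import Data.List.Relation.Unary.Unique.Propositional using (Unique; []; _∷_)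
  import Data.List.Relation.Unary.Unique.Propositional.Properties as UniqueP
  open import Data.Nat using (ℕ; _≤_; _<_; _+_; _*_)
  open import Data.Nat.Properties using (<⇒≢; +-cancelˡ-≡; m≤m+n; +-monoʳ-<)
  open import Data.Product using (_×_; _,_)
  open import Relation.Binary.PropositionalEquality.Properties using (setoid)
  open import Level using (Level)

  private variable
    a b c : Level
    A B C : Set a

  range : ℕ → ℕ → List ℕ
  range s n = applyUpTo (s +_) n

  range-unique : ∀ s n → Unique (range s n)
  range-unique s n = UniqueP.applyUpTo⁺₁ (s +_) n (λ i<j _ eq → <⇒≢ i<j (+-cancelˡ-≡ s _ _ eq))

  range-bounds : ∀ s n → All (λ x → (s ≤ x) × (x < s + n)) (range s n)
  range-bounds s n = AllP.applyUpTo⁺₁ (s +_) n (λ {i} i<n → m≤m+n s i , +-monoʳ-< s i<n)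

  range-length : ∀ s n → length (range s n) ≡ n
  range-length s n = length-applyUpTo (s +_) n

  All-cartesianProductWith : ∀ {P : A → Set} {Q : B → Set} {R : C → Set} (f : A → B → C) {xs ys} →
    (∀ {x y} → P x → Q y → R (f x y)) → All P xs → All Q ys → All R (cartesianProductWith f xs ys)
  All-cartesianProductWith f h ps qs =
    AllP.cartesianProductWith⁺ (setoid _) (setoid _) f _ _ (λ x∈ y∈ → h (All.lookup ps x∈) (All.lookup qs y∈))

  length-cartesianProductWith : ∀ (f : A → B → C) xs ys → length (cartesianProductWith f xs ys) ≡ length xs * length ys
  length-cartesianProductWith f [] ys = refl
  length-cartesianProductWith f (x ∷ xs) ys =
    trans (length-++ (map (f x) ys)) (cong₂ _+_ (length-map (f x) ys) (length-cartesianProductWith f xs ys))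

  Unique-++ : ∀ {P Q : A → Set} {xs ys} → Unique xs → Unique ys → All P xs → All Q ys →
    (∀ {x y} → P x → Q y → x ≢ y) → Unique (xs ++ ys)
  Unique-++ ux uy ps qs incompatible =
    UniqueP.++⁺ ux uy (λ (x∈xs , x∈ys) → incompatible (All.lookup ps x∈xs) (All.lookup qs x∈ys) refl)

  Unique-map : ∀ {V : A → Set} (f : A → B) {xs} → All V xs → (∀ {x y} → V x → V y → f x ≡ f y → x ≡ y) →
    Unique xs → Unique (map f xs)
  Unique-map f [] inj [] = []
  Unique-map f {x ∷ xs} (vx ∷ vs) inj (x∉ ∷ ux) = AllP.map⁺ (images-differ vs x∉) ∷ Unique-map f vs inj ux
    where
    images-differ : ∀ {ys} → All _ ys → All (x ≢_) ys → All (λ y → f x ≢ f y) ys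
    images-differ [] [] = []
    images-differ (vy ∷ vys) (x≢y ∷ x≢ys) = (λ e → x≢y (inj vx vy e)) ∷ images-differ vys x≢ys

module Enumeration (A B : ℕ) (B≤A : B ≤ A) where

  open ListFacts
  open Construction using (IrreducibleOfPeriod; Choice; ExponentAbove)
  open import Data.List using (List; []; _∷_; length; _++_; cartesianProductWith; cartesianProduct)
  open import Data.List.Properties using (length-++; ∷-injective)
  open import Data.List.Relation.Unary.All as All using (All; []; _∷_)
  import Data.List.Relation.Unary.All.Properties as AllP
  open import Data.List.Relation.Unary.Unique.Propositional using (Unique; []; _∷_)
  import Data.List.Relation.Unary.Unique.Propositional.Properties as UniqueP
  open import Data.Nat using (ℕ; zero; suc; _≤_; _<_; z≤n; s≤s; _+_; _*_; _∸_; _^_)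
  open import Data.Nat.Properties
  open import Algebra.Properties.CommutativeSemigroup *-commutativeSemigroup using (interchange)
  open import Data.Fin using (zero; suc)
  open import Data.Empty using (⊥)
  open import Data.Unit using (⊤; tt)
  open import Data.Sum using (inj₁; inj₂)
  open import Data.Product using (_×_; _,_)

  Choices : Set
  Choices = List (List (Poly × ℕ))

  extend : List Poly → List ℕ → Choices → Choices
  extend L bs rest = cartesianProductWith _∷_ (cartesianProduct L bs) rest

  allChoices : (r : ℕ) → (Fin r → List Poly) → Choices
  allChoices zero L = [] ∷ []
  allChoices (suc r) L = extend (L zero) (range 1 A) (allChoices r (λ i → L (suc i)))

  -- Some exponent exceeds B: either the first one (and the rest is arbitrary), or the first one
  -- is ≤ B and a later one exceeds B.
  highChoices : (r : ℕ) → (Fin r → List Poly) → Choices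
  highChoices zero L = []
  highChoices (suc r) L = extend (L zero) (range (suc B) (A ∸ B)) (allChoices r (λ i → L (suc i)))
                       ++ extend (L zero) (range 1 B) (highChoices r (λ i → L (suc i)))

  extend-all : ∀ {P : Poly → Set} {Q : ℕ → Set} {R S : List (Poly × ℕ) → Set} {L bs rest} →
    (∀ {p b cs} → P p → Q b → R cs → S ((p , b) ∷ cs)) → All P L → All Q bs → All R rest → All S (extend L bs rest)
  extend-all h pL qbs rrest = All-cartesianProductWith _∷_ (λ (pp , qb) rcs → h pp qb rcs) (All-cartesianProductWith _,_ _,_ pL qbs) rrest

  extend-unique : ∀ {L bs rest} → Unique L → Unique bs → Unique rest → Unique (extend L bs rest)
  extend-unique uL ubs urest = UniqueP.cartesianProductWith⁺ _∷_ ∷-injective (UniqueP.cartesianProduct⁺ uL ubs) urest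

  extend-length : ∀ L s n rest → length (extend L (range s n) rest) ≡ (length L * n) * length rest
  extend-length L s n rest = trans (length-cartesianProductWith _∷_ (cartesianProduct L (range s n)) rest)
    (cong (_* length rest) (trans (length-cartesianProductWith _,_ L (range s n)) (cong (length L *_) (range-length s n))))

  allChoices-unique : ∀ r L → (∀ i → Unique (L i)) → Unique (allChoices r L)
  allChoices-unique zero L u = [] ∷ []
  allChoices-unique (suc r) L u = extend-unique (u zero) (range-unique 1 A) (allChoices-unique r (λ i → L (suc i)) (λ i → u (suc i)))

  HeadAbove : List (Poly × ℕ) → Set
  HeadAbove [] = ⊥
  HeadAbove ((p , b) ∷ _) = B < b

  everywhere : ∀ {X : Set} (xs : List X) → All (λ _ → ⊤) xs
  everywhere xs = All.universal (λ _ → tt) xs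

  highChoices-unique : ∀ r L → (∀ i → Unique (L i)) → Unique (highChoices r L)
  highChoices-unique zero L u = []
  highChoices-unique (suc r) L u = Unique-++ {P = HeadAbove} {Q = λ cs → HeadAbove cs → ⊥}
    (extend-unique (u zero) (range-unique (suc B) (A ∸ B)) (allChoices-unique r L' u'))
    (extend-unique (u zero) (range-unique 1 B) (highChoices-unique r L' u'))
    (extend-all (λ _ (B<b , _) _ → B<b) (everywhere (L zero)) (range-bounds (suc B) (A ∸ B)) (everywhere (allChoices r L')))
    (extend-all (λ _ (_ , b<1+B) _ → ≤⇒≯ (≤-pred b<1+B)) (everywhere (L zero)) (range-bounds 1 B) (everywhere (highChoices r L')))
    (λ above not-above x≡y → not-above (subst HeadAbove x≡y above))
    where
    L' = λ i → L (suc i)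
    u' = λ i → u (suc i)

  Exponent : ℕ → Set
  Exponent b = (1 ≤ b) × (b ≤ A)

  all-exponents : ∀ {b} → (1 ≤ b) × (b < 1 + A) → Exponent b
  all-exponents (1≤b , b<) = 1≤b , ≤-pred b<

  high-exponents : ∀ {b} → (suc B ≤ b) × (b < suc B + (A ∸ B)) → Exponent b
  high-exponents {b} (B<b , b<) = ≤-trans (s≤s z≤n) B<b , subst (b ≤_) (m+[n∸m]≡n B≤A) (≤-pred b<)

  low-exponents : ∀ {b} → (1 ≤ b) × (b < 1 + B) → Exponent b
  low-exponents (1≤b , b<) = 1≤b , ≤-trans (≤-pred b<) B≤A

  allChoices-choice : ∀ r m L → (∀ i → All (IrreducibleOfPeriod (m i)) (L i)) → All (Choice A r m) (allChoices r L)
  allChoices-choice zero m L irr = tt ∷ []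
  allChoices-choice (suc r) m L irr =
    extend-all (λ ip (1≤b , b≤A) v → ip , 1≤b , b≤A , v) (irr zero) (All.map all-exponents (range-bounds 1 A))
               (allChoices-choice r (λ i → m (suc i)) (λ i → L (suc i)) (λ i → irr (suc i)))

  highChoices-choice : ∀ r m L → (∀ i → All (IrreducibleOfPeriod (m i)) (L i)) → All (Choice A r m) (highChoices r L)
  highChoices-choice zero m L irr = []
  highChoices-choice (suc r) m L irr = AllP.++⁺
    (extend-all (λ ip (1≤b , b≤A) v → ip , 1≤b , b≤A , v) (irr zero) (All.map high-exponents (range-bounds (suc B) (A ∸ B)))
                (allChoices-choice r m' L' irr'))
    (extend-all (λ ip (1≤b , b≤A) v → ip , 1≤b , b≤A , v) (irr zero) (All.map low-exponents (range-bounds 1 B))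
                (highChoices-choice r m' L' irr'))
    where
    m' = λ i → m (suc i)
    L' = λ i → L (suc i)
    irr' = λ i → irr (suc i)

  highChoices-above : ∀ r L → All (ExponentAbove B) (highChoices r L)
  highChoices-above zero L = []
  highChoices-above (suc r) L = AllP.++⁺
    (extend-all (λ _ (B<b , _) _ → inj₁ B<b) (everywhere (L zero)) (range-bounds (suc B) (A ∸ B)) (everywhere (allChoices r L')))
    (extend-all (λ _ _ above → inj₂ above) (everywhere (L zero)) (everywhere (range 1 B)) (highChoices-above r L'))
    where
    L' = λ i → L (suc i)

  allChoices-length : ∀ r L → length (allChoices r L) ≡ prodFin r (λ i → length (L i)) * A ^ r
  allChoices-length zero L = refl
  allChoices-length (suc r) L = begin
      length (extend (L zero) (range 1 A) (allChoices r L'))     ≡⟨ extend-length (L zero) 1 A (allChoices r L') ⟩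
      (g₀ * A) * length (allChoices r L')                        ≡⟨ cong ((g₀ * A) *_) (allChoices-length r L') ⟩
      (g₀ * A) * (P * A ^ r)                                     ≡⟨ interchange g₀ A P (A ^ r) ⟩
      (g₀ * P) * (A * A ^ r)                                     ∎
    where
    open ≡-Reasoning
    L' = λ i → L (suc i)
    g₀ = length (L zero)
    P = prodFin r (λ i → length (L' i))

  split-difference : ∀ X Y → Y ≤ X → (A ∸ B) * X + B * (X ∸ Y) ≡ A * X ∸ B * Y
  split-difference X Y Y≤X = begin
      (A ∸ B) * X + B * (X ∸ Y)          ≡⟨ cong₂ _+_ (*-distribʳ-∸ X A B) (*-distribˡ-∸ B X Y) ⟩
      (A * X ∸ B * X) + (B * X ∸ B * Y)  ≡⟨ +-∸-assoc (A * X ∸ B * X) (*-monoʳ-≤ B Y≤X) ⟨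
      (A * X ∸ B * X) + B * X ∸ B * Y    ≡⟨ cong (_∸ B * Y) (m∸n+n≡m (*-monoˡ-≤ X B≤A)) ⟩
      A * X ∸ B * Y                      ∎
    where open ≡-Reasoning

  highChoices-length : ∀ r L → length (highChoices r L) ≡ prodFin r (λ i → length (L i)) * (A ^ r ∸ B ^ r)
  highChoices-length zero L = refl
  highChoices-length (suc r) L = begin
      length (extend (L zero) high all' ++ extend (L zero) low high')
        ≡⟨ length-++ (extend (L zero) high all') ⟩
      length (extend (L zero) high all') + length (extend (L zero) low high')
        ≡⟨ cong₂ _+_ (extend-length (L zero) (suc B) (A ∸ B) all') (extend-length (L zero) 1 B high') ⟩
      (g₀ * (A ∸ B)) * length all' + (g₀ * B) * length high'
        ≡⟨ cong₂ (λ x y → (g₀ * (A ∸ B)) * x + (g₀ * B) * y) (allChoices-length r L') (highChoices-length r L') ⟩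
      (g₀ * (A ∸ B)) * (P * A ^ r) + (g₀ * B) * (P * (A ^ r ∸ B ^ r))
        ≡⟨ cong₂ _+_ (interchange g₀ (A ∸ B) P (A ^ r)) (interchange g₀ B P (A ^ r ∸ B ^ r)) ⟩
      (g₀ * P) * ((A ∸ B) * A ^ r) + (g₀ * P) * (B * (A ^ r ∸ B ^ r))
        ≡⟨ *-distribˡ-+ (g₀ * P) ((A ∸ B) * A ^ r) (B * (A ^ r ∸ B ^ r)) ⟨
      (g₀ * P) * ((A ∸ B) * A ^ r + B * (A ^ r ∸ B ^ r))
        ≡⟨ cong ((g₀ * P) *_) (split-difference (A ^ r) (B ^ r) (^-monoˡ-≤ r B≤A)) ⟩
      (g₀ * P) * (A * A ^ r ∸ B * B ^ r) ∎
    where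
    open ≡-Reasoning
    L' = λ i → L (suc i)
    g₀ = length (L zero)
    P = prodFin r (λ i → length (L' i))
    high = range (suc B) (A ∸ B)
    low = range 1 B
    all' = allChoices r L'
    high' = highChoices r L'

module AdmissibleData (r : ℕ) (m e : Fin r → ℕ) (t : ℕ) (pr : ∀ i → Prime (m i)) (od : ∀ i → PrimePowers.Odd (m i))
                      (ep : ∀ i → 1 ≤ e i) (inj : Injective _≡_ _≡_ m)
                      (g : Fin r → ℕ) (L : Fin r → List Poly)
                      (L-facts : ∀ i → (length (L i) ≡ g i) × Unique (L i) × All (Construction.IrreducibleOfPeriod (m i)) (L i))
                      where

  open PrimePowers using (prodFin-cong)
  open ListFacts
  open Construction using (module Candidates)
  open Candidates r m e t pr od ep inj public
  open import Data.List using (map; _++_; cartesianProduct)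
  open import Data.List.Properties using (length-map; length-++)
  import Data.List.Relation.Unary.All.Properties as AllP
  import Data.List.Relation.Unary.Unique.Propositional.Properties as UniqueP
  open import Data.Nat using (zero; suc; _<_; z≤n; s≤s; _+_; _*_; _∸_; _^_)
  open import Data.Nat.Properties
  open import Data.Sum using (inj₁; inj₂)
  open import Data.Product using (_×_; _,_; proj₁; proj₂)

  L-length : ∀ i → length (L i) ≡ g i
  L-length i = proj₁ (L-facts i)

  L-unique : ∀ i → Unique (L i)
  L-unique i = proj₁ (proj₂ (L-facts i))

  L-irreducible : ∀ i → All (Construction.IrreducibleOfPeriod (m i)) (L i)
  L-irreducible i = proj₂ (proj₂ (L-facts i))

  B≤A : B ≤ A
  B≤A = ^-monoʳ-≤ 2 (m∸n≤m t 1)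

  B<A : 0 < t → B < A
  B<A = halving t
    where
    halving : ∀ t → 0 < t → 2 ^ (t ∸ 1) < 2 ^ t
    halving (suc t') _ = ^-monoʳ-< 2 (s≤s (s≤s z≤n)) (n<1+n t')

  open Enumeration A B B≤A

  Data : Set
  Data = ℕ × List (Poly × ℕ)

  fullExponent lowerExponents : List Data
  fullExponent = map (A ,_) (allChoices r L)
  lowerExponents = cartesianProduct (range 1 (A ∸ 1)) (highChoices r L)

  admissibleData : List Data
  admissibleData = fullExponent ++ lowerExponents

  a<A : ∀ {a} → a < 1 + (A ∸ 1) → a < A
  a<A {a} a< = subst (a <_) (m+[n∸m]≡n A≥1) a<

  admissibleData-admissible : All Admissible admissibleData
  admissibleData-admissible = AllP.++⁺
    (AllP.map⁺ (All.map (λ v → A≥1 , ≤-refl , v , λ t>0 → inj₁ (B<A t>0)) (allChoices-choice r m L L-irreducible)))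
    (All-cartesianProductWith _,_ (λ (1≤a , a<) (v , above) → 1≤a , <⇒≤ (a<A a<) , v , λ _ → inj₂ above)
      (range-bounds 1 (A ∸ 1)) (All.zip (highChoices-choice r m L L-irreducible , highChoices-above r L)))

  admissibleData-unique : Unique admissibleData
  admissibleData-unique = Unique-++ {P = λ x → proj₁ x ≡ A} {Q = λ x → proj₁ x < A}
    (UniqueP.map⁺ (cong proj₂) (allChoices-unique r L L-unique))
    (UniqueP.cartesianProduct⁺ (range-unique 1 (A ∸ 1)) (highChoices-unique r L L-unique))
    (AllP.map⁺ (All.universal (λ _ → refl) (allChoices r L)))
    (All-cartesianProductWith _,_ (λ (_ , a<) _ → a<A a<) (range-bounds 1 (A ∸ 1)) (All.universal (λ _ → tt) (highChoices r L)))
    (λ { refl a<A refl → <-irrefl refl a<A })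

  admissibleData-length : length admissibleData ≡
    (2 ^ t ∸ 1) * (2 ^ (t * r) ∸ 2 ^ ((t ∸ 1) * r)) * prodFin r g + 2 ^ (t * r) * prodFin r g
  admissibleData-length = begin
      length (fullExponent ++ lowerExponents)                 ≡⟨ length-++ fullExponent ⟩
      length fullExponent + length lowerExponents             ≡⟨ cong₂ _+_ (length-map (A ,_) (allChoices r L))
                                                                  (length-cartesianProductWith _,_ (range 1 (A ∸ 1)) (highChoices r L)) ⟩
      length (allChoices r L) + length (range 1 (A ∸ 1)) * length (highChoices r L)
                                                              ≡⟨ cong₂ _+_ (allChoices-length r L)
                                                                  (cong₂ _*_ (range-length 1 (A ∸ 1)) (highChoices-length r L)) ⟩
      P' * A ^ r + (A ∸ 1) * (P' * (A ^ r ∸ B ^ r))           ≡⟨ cong₂ (λ Q X → Q * X + (A ∸ 1) * (Q * (X ∸ B ^ r))) P'≡P (^-*-assoc 2 t r) ⟩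
      P * X + (A ∸ 1) * (P * (X ∸ B ^ r))                     ≡⟨ cong (λ Y → P * X + (A ∸ 1) * (P * (X ∸ Y))) (^-*-assoc 2 (t ∸ 1) r) ⟩
      P * X + (A ∸ 1) * (P * (X ∸ Y))                         ≡⟨ rearrange P X (A ∸ 1) (X ∸ Y) ⟩
      (A ∸ 1) * (X ∸ Y) * P + X * P                           ∎
    where
    open ≡-Reasoning
    P' = prodFin r (λ i → length (L i))
    P = prodFin r g
    P'≡P : P' ≡ P
    P'≡P = prodFin-cong r L-length
    X = 2 ^ (t * r)
    Y = 2 ^ ((t ∸ 1) * r)
    rearrange : ∀ P X a D → P * X + a * (P * D) ≡ a * D * P + X * P
    rearrange = solve 4 (λ P X a D → P :* X :+ a :* (P :* D) := a :* D :* P :+ X :* P) refl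
      where open import Data.Nat.Solver using (module +-*-Solver)
            open +-*-Solver

open import Data.Nat using (_*_; _+_; _∸_; _^_; _<_)
open import Data.Nat.DivMod using (_%_)
open import Data.List using (map)
open import Data.List.Properties using (length-map)
import Data.List.Relation.Unary.All.Properties as AllP
open import Data.Product using (_,_; proj₁; proj₂)

atLeast-by-injection : ∀ {X : Set} {V : X → Set} {P : Poly → Set} (f : X → Poly) {xs : List X} →
  Unique xs → All V xs → (∀ {x y} → V x → V y → f x ≡ f y → x ≡ y) → (∀ {x} → V x → Normal (f x) × P (f x)) →
  AtLeast P (length xs)
atLeast-by-injection f {xs} unique valid injective good =
  map f xs , length-map f xs , ListFacts.Unique-map f valid injective unique ,
  AllP.map⁺ (All.map (λ v → proj₁ (good v)) valid) , AllP.map⁺ (All.map (λ v → proj₂ (good v)) valid)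

counted-irreducibles : ∀ {m n} (c : IsCount (λ f → ConstOne f × Irreducible f × HasPeriod f m) n) →
  (length (proj₁ c) ≡ n) × Unique (proj₁ c) × All (Construction.IrreducibleOfPeriod m) (proj₁ c)
counted-irreducibles (_ , length≡ , unique , _ , good , _) = length≡ , unique , All.map (λ (_ , irr , per) → irr , per) good

theorem13 : (r : ℕ) (m e : Fin r → ℕ) (t T : ℕ) →
  Injective _≡_ _≡_ m →
  (∀ i → Prime (m i)) →
  (∀ i → m i % 2 ≡ 1) →
  (∀ i → 0 < e i) →
  T ≡ prodFin r (λ i → m i ^ e i) * 2 ^ t →
  (g : Fin r → ℕ) →
  (∀ i → IsCount (λ f → ConstOne f × Irreducible f × HasPeriod f (m i)) (g i)) →
  AtLeast (λ f → ConstOne f × (x+1 ∣P f) × HasPeriod f T)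
    ((2 ^ t ∸ 1) * (2 ^ (t * r) ∸ 2 ^ ((t ∸ 1) * r)) * prodFin r g
      + 2 ^ (t * r) * prodFin r g)
theorem13 r m e t _ inj prime odd e>0 refl g counts =
  subst (AtLeast Wanted) admissibleData-length
    (atLeast-by-injection polynomial admissibleData-unique admissibleData-admissible polynomial-injective polynomial-wanted)
  where
  open AdmissibleData r m e t prime (λ i → PrimePowers.%2≡1⇒odd (odd i)) e>0 inj
         g (λ i → proj₁ (counts i)) (λ i → counted-irreducibles (counts i))
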